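{- Let $f:2^{\mathcal N}\to\mathbb R_{\ge 0}$ be a non-negative, not necessarily monotone, submodular function with $|\mathcal N|=n$, let $c:\mathcal N\to(0,\infty)$, $B>0$ with $c(u)\le B$ for all $u\in\mathcal N$, let $\alpha\in(0,1)$ and let $\varepsilon\in(0,1)$ be a fixed constant. Let $r$ be the maximum cardinality of a set $X\subseteq\mathcal N$ with $c(X)\le B$. Then the adaptive complexity and the query complexity of the algorithm $\mathsf{ParSKP}(\alpha,\varepsilon,B,f,c)$ (defined in the context) are $\mathcal O(\log n)$ and $\mathcal O(nr\log^2 n)$ respectively (when the indices $t_1,t_2$ in its subroutine $\mathsf{RandBatch}$ are found by evaluating all indices in parallel), or $\mathcal O(\log n\log r)$ and $\mathcal O(n\log^2 n\log r)$ respectively (when $t_1,t_2$ are found by binary search).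
   Context: $\mathcal N$ is a finite ground set. A function $f:2^{\mathcal N}\to\mathbb R$ is submodular if $f(X)+f(Y)\ge f(X\cup Y)+f(X\cap Y)$ for all $X,Y\subseteq\mathcal N$. Write $f(u\mid X)=f(X\cup\{u\})-f(X)$, $f(u)=f(\{u\})$, $c(X)=\sum_{u\in X}c(u)$. The feasible family is $\mathcal I=\{X\subseteq\mathcal N: c(X)\le B\}$. **Complexity measures.** $f$ is accessed through an oracle returning $f(X)$ for a queried $X\subseteq\mathcal N$. The query complexity of an algorithm is its number of oracle queries. Its adaptive complexity (adaptivity) is its number of adaptive rounds, where in each round polynomially many (in $n$) oracle queries may be made in parallel, and these queries may depend only on results of previous rounds. The $\mathcal O(\cdot)$ treats $\varepsilon$ as constant. **USM.** $\mathsf{USM}(X)$ is an algorithm returning a subset of $X$ that is a $(1/2-\varepsilon)$-approximation for $\max_{Y\subseteq X}f(Y)$ and uses $\mathcal O(\frac1\varepsilon\log\frac1\varepsilon)$ adaptive rounds and $\mathcal O(\frac{n}{\varepsilon^4}\log^3\frac1\varepsilon)$ queries. **GetSEQ$(A,L)$.** Start with the empty sequence $V$. While $L\ne\emptyset$: draw a uniformly random permutation $v_1,\dots,v_{|L|}$ of $L$; let $s=\max\{i: A\cup V\cup\{v_1,\dots,v_i\}\in\mathcal I\}$; append $v_1,\dots,v_s$ to $V$; replace $L$ by $\{u\in L\setminus V: A\cup V\cup\{u\}\in\mathcal I\}$. Return the ordered sequence $V$. (It makes no oracle queries to $f$.) **RandBatch$(\rho,I,M,p,\varepsilon,f,c)$**,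 for a threshold $\rho>0$, a set $I\subseteq\mathcal N$, a positive integer $M$, a probability $p$ and $\varepsilon\in(0,1)$. Set $A=U=\emptyset$, $count=0$, $L=\{u\in I: f(u\mid A)/c(u)\ge\rho,\ A\cup\{u\}\in\mathcal I\}$. While $L\neq\emptyset$ and $count<M$: (i) $(v_1,\dots,v_d)=\mathsf{GetSEQ}(A,L)$; (ii) for $0\le i\le d$ let $V_i=\{v_1,\dots,v_i\}$, $G_i=A\cup V_i$, $E_i^+=\{u\in L: f(u\mid G_i)/c(u)\ge\rho,\ G_i\cup\{u\}\in\mathcal I\}$, $E_i^-=\{u\in L: f(u\mid G_i)<0\}$, $D_i=\{v_j: 1\le j\le i,\ f(v_j\mid A\cup V_{j-1})<0\}$; (iii) let $t_1$ be the least $i\le d$ with $c(E_i^+)\le(1-\varepsilon)c(L)$, let $t_2$ be the least $i\le d$ with $\varepsilon\sum_{u\in E_i^+}f(u\mid G_i)\le\sum_{u\in E_i^- }|f(u\mid G_i)|+\sum_{v_j\in D_i}|f(v_j\mid A\cup V_{j-1})|$, let $t^*=\min\{t_1,t_2\}$, and set $U\leftarrow U\cup V_{t^*}$; (iv) with probability $p$ (independently) do: $A\leftarrow A\cup V_{t^*}$ and, if $t_2<t_1$, $count\leftarrow count+1$; (v) $L\leftarrow\{u\in L\setminus U: f(u\mid A)/c(u)\ge\rho,\ A\cup\{u\}\in\mathcal I\}$. Return $(A,U,L)$. Two implementations of (iii): either all $i\in\{0,\dots,d\}$ are evaluated in parallel, or $t_1$ and $t_2$ are found by binary search over $i$ (so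 the quantities in (ii) are computed only for the indices probed). **Probe$(\rho,\mathcal N_1,\mathcal N_2,\varepsilon,B,f,c)$.** Set $T=\emptyset$, $M=\lceil\varepsilon^{ -2}\rceil$, $p=1$. Let $(A_1,U_1,L_1)=\mathsf{RandBatch}(\rho,\mathcal N_1,M,p,\varepsilon,f,c)$ and $(A_2,U_2,L_2)=\mathsf{RandBatch}(\rho,\mathcal N_1\setminus A_1,M,p,\varepsilon,f,c)$. For $i=1,2$: let $e_i$ maximize $f(A_i\cup\{u\})$ over $u\in\mathcal N_1$ with $c(A_i\cup\{u\})\le B$ (if such $u$ exists), and replace $T$ by a set of largest $f$-value among $T,A_i,A_i\cup\{e_i\}$. If $c(\mathcal N_2\cup A_1)\le B$: let $A_3=\mathsf{USM}(\mathcal N_2\cup A_1)$ and replace $T$ by the better (in $f$-value) of $T,A_3$. Return $T$. **ParSKP$(\alpha,\varepsilon,B,f,c)$.** Let $\mathcal N_1=\{u\in\mathcal N: c(u)>\varepsilon B/n\}$, $\mathcal N_2=\mathcal N\setminus\mathcal N_1$, $u^*\in\arg\max_{u\in\mathcal N}f(u)$. Let $S$ be the better (in $f$-value) of $\mathsf{USM}(\mathcal N_2)$ and $\{u^*\}$. Let $\rho_{\min}=\alpha f(u^*)/B$, $\rho_{\max}=n^2\alpha f(u^*)/(\varepsilon B)$, $Z=\{(1-\varepsilon)^{ -z}: z\in\mathbb Z,\ (1-\varepsilon)^{ -z}\in[\rho_{\min},\rho_{\max}]\}$. For every $\rho\in Z$ run $\mathsf{Probe}(\rho,\mathcal N_1,\mathcal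 N_2,\varepsilon,B,f,c)$ independently $\lceil\log_{1-\varepsilon}\varepsilon\rceil$ times, all runs being executed in parallel. Return the set of largest $f$-value among $S$ and all sets returned by the runs of $\mathsf{Probe}$. -}

module Defs where

open import Level using (0ℓ)
open import Algebra.Bundles using (CommutativeRing)
open import Algebra.Core using (Op₁)
import Algebra.Definitions.RawMonoid as RawMonoidDefs
open import Data.Bool.Base using (Bool; true; false; if_then_else_)
import Data.Bool.Properties as Bool
open import Data.Fin.Base using (Fin)
open import Data.Fin.Subset using (Subset; ⊥; ∁; _⊆_; _∪_; _∩_; _─_; ⁅_⁆; ⋃; ∣_∣)
open import Data.Fin.Subset.Properties using (_∈?_; nonempty?)
open import Data.Integer.Base as ℤ using (ℤ; +_; -[1+_])
open import Data.List.Base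
  using (List; []; _∷_; [_]; _++_; map; concat; concatMap; filter; foldr; length; take;
         zip; zipWith; replicate; upTo; allFin; alignWith; cartesianProductWith)
import Data.List.Extrema as Extrema
open import Data.List.Membership.Propositional using () renaming (_∈_ to _∈ˡ_)
open import Data.List.Membership.Propositional.Properties
  using (∈-map⁺; ∈-filter⁺; ∈-++⁺ˡ; ∈-++⁺ʳ; ∈-upTo⁺)
open import Data.List.Relation.Binary.Pointwise.Base using (Pointwise)
open import Data.List.Relation.Unary.All using (All)
open import Data.List.Relation.Unary.Any using (any?)
open import Data.Nat.Base as ℕ using (ℕ; zero; suc; ⌊_/2⌋)
open import Data.Nat.Logarithm using (⌊log₂_⌋)
open import Data.Nat.ListAction using (sum)
import Data.Nat.Properties as ℕ
open import Data.Product.Base using (∃; _×_; _,_; proj₁; proj₂)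
import Data.These.Base as These
import Data.Vec.Base as Vec
import Data.Vec.Properties as Vec
open import Function.Base using (_∘_; id)
open import Relation.Binary.Bundles using (TotalOrder)
open import Relation.Binary.Core using (Rel)
open import Relation.Binary.Definitions using (DecidableEquality)
import Relation.Binary.Construct.NonStrictToStrict as NonStrictToStrict
open import Relation.Binary.PropositionalEquality as ≡ using (_≡_)
open import Relation.Binary.Structures using (IsDecTotalOrder)
open import Relation.Nullary using (¬_; Dec; yes; no; does; _×-dec_; contradiction)
open import Relation.Unary using (Pred; Decidable)

-- The properties of ℝ that are used: classically ℝ is an instance, and so is
-- ℚ.  Comparisons are decidable because algorithms branch on them.  The inverse
-- is total, with an unspecified value at zero.
record ArchimedeanOrderedField : Set₁ where
  infix  4 _≤_
  infix  8 _⁻¹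
  field
    commutativeRing : CommutativeRing 0ℓ 0ℓ
  open CommutativeRing commutativeRing
  field
    _≤_             : Rel Carrier 0ℓ
    isDecTotalOrder : IsDecTotalOrder _≈_ _≤_
    +-monoˡ-≤       : ∀ z {x y} → x ≤ y → x + z ≤ y + z
    *-nonNegative   : ∀ {x y} → 0# ≤ x → 0# ≤ y → 0# ≤ x * y
    0≉1             : ¬ 0# ≈ 1#
    _⁻¹             : Op₁ Carrier
    ⁻¹-cong         : ∀ {x y} → x ≈ y → x ⁻¹ ≈ y ⁻¹
    *-inverseʳ      : ∀ {x} → ¬ x ≈ 0# → x * x ⁻¹ ≈ 1#
  open RawMonoidDefs +-rawMonoid using () renaming (_×_ to _·_)
  field
    archimedean     : ∀ x → ∃ λ n → x ≤ n · 1#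

-- The least i ≤ b satisfying P, or b if there is none.
least : {P : Pred ℕ 0ℓ} → Decidable P → ℕ → ℕ
least P? zero    = zero
least P? (suc b) = if does (P? 0) then 0 else suc (least (P? ∘ suc) b)

-- The greatest i ≤ b satisfying P, or 0 if there is none.
greatest : {P : Pred ℕ 0ℓ} → Decidable P → ℕ → ℕ
greatest P? zero    = zero
greatest P? (suc b) = if does (P? (suc b)) then suc b else greatest P? b

least-satisfies : {P : Pred ℕ 0ℓ} (P? : Decidable P) (b : ℕ) → P b → P (least P? b)
least-satisfies P? zero    Pb = Pb
least-satisfies P? (suc b) Pb with P? 0
... | yes P0 = P0
... | no  _  = least-satisfies (P? ∘ suc) b Pb

module Field (F : ArchimedeanOrderedField) where

  open ArchimedeanOrderedField F public
  open CommutativeRing commutativeRing public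
    using (Carrier; _≈_; _+_; _*_; -_; _-_; 0#; 1#)
  open import Algebra.Properties.Semiring.Exp (CommutativeRing.semiring commutativeRing) public
    using (_^_)
  open RawMonoidDefs (CommutativeRing.+-rawMonoid commutativeRing) using () renaming (_×_ to _·_)
  open IsDecTotalOrder isDecTotalOrder public using (_≤?_; _≟_)

  totalOrder : TotalOrder 0ℓ 0ℓ 0ℓ
  totalOrder = record { isTotalOrder = IsDecTotalOrder.isTotalOrder isDecTotalOrder }

  open NonStrictToStrict _≈_ _≤_ public using (_<_)
  open Extrema totalOrder public using (argmax)

  infix  4 _<?_
  infixl 7 _/_
  infixr 8 _^ℤ_

  _<?_ : ∀ x y → Dec (x < y)
  _<?_ = NonStrictToStrict.<-decidable _≈_ _≤_ _≟_ _≤?_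

  _/_ : Carrier → Carrier → Carrier
  x / y = x * y ⁻¹

  fromℕ : ℕ → Carrier
  fromℕ n = n · 1#

  _^ℤ_ : Carrier → ℤ → Carrier
  x ^ℤ (+ k)    = x ^ k
  x ^ℤ -[1+ k ] = (x ⁻¹) ^ suc k

  abs : Carrier → Carrier
  abs x = if does (0# ≤? x) then x else - x

  Σ[_] : {A : Set} → List A → (A → Carrier) → Carrier
  Σ[ xs ] g = foldr (λ x s → g x + s) 0# xs

  ⌈_⌉ : Carrier → ℕ
  ⌈ x ⌉ = least (λ k → x ≤? fromℕ k) (proj₁ (archimedean x))

  -- ⌈log_b x⌉ for b > 1 (and 0 if x ≤ 1): the least k with x ≤ b ^ k.  The
  -- search bound suffices by Bernoulli's inequality; see ⌈log⌉-spec.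
  ⌈log_⌉ : Carrier → Carrier → ℕ
  ⌈log b ⌉ x = least (λ k → x ≤? b ^ k) (proj₁ (archimedean (x / (b - 1#))))

  -- { b ^ (- z) : z ∈ ℤ } ∩ [lo, hi] for 0 < b < 1; see grid-spec.
  exponents : Carrier → Carrier → Carrier → List ℤ
  exponents b lo hi =
    map +_ (upTo (suc (⌈log b ⁻¹ ⌉ hi))) ++ map -[1+_] (upTo (⌈log b ⁻¹ ⌉ (lo ⁻¹)))

  grid : Carrier → Carrier → Carrier → List Carrier
  grid b lo hi =
    filter (λ x → (lo ≤? x) ×-dec (x ≤? hi)) (map (λ z → b ^ℤ (ℤ.- z)) (exponents b lo hi))

  module Properties where
    open CommutativeRing commutativeRing
      using (refl; sym; trans; ring; +-assoc; +-comm; +-congˡ; +-congʳ; +-identityˡ; +-identityʳ;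
             -‿cong; -‿inverseʳ; -‿inverseˡ; *-assoc; *-comm; *-congˡ; *-congʳ; *-identityˡ;
             *-identityʳ; distribʳ; zeroˡ; zeroʳ)
    open import Algebra.Properties.Ring ring
      using (-‿distribˡ-*; x[y-z]≈xy-xz; -‿involutive)
    open import Algebra.Properties.CommutativeSemiring.Exp
      (CommutativeRing.commutativeSemiring commutativeRing) using (^-distrib-*)
    open IsDecTotalOrder isDecTotalOrder
      using (antisym; total; ≤-respˡ-≈; ≤-respʳ-≈)
      renaming (reflexive to ≤-reflexive; refl to ≤-refl; trans to ≤-trans)

    <⇒≱ : ∀ {x y} → x < y → ¬ y ≤ x
    <⇒≱ = NonStrictToStrict.<⇒≱ _≈_ _≤_ antisym

    ≰⇒> : ∀ {x y} → ¬ x ≤ y → y < x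
    ≰⇒> = NonStrictToStrict.≰⇒> _≈_ _≤_ sym ≤-reflexive total

    ≰⇒≥ : ∀ {x y} → ¬ x ≤ y → y ≤ x
    ≰⇒≥ = proj₁ ∘ ≰⇒>

    ≤⇒0≤- : ∀ {x y} → x ≤ y → 0# ≤ y - x
    ≤⇒0≤- {x} = ≤-respˡ-≈ (-‿inverseʳ x) ∘ +-monoˡ-≤ (- x)

    x-y+y≈x : ∀ x y → x - y + y ≈ x
    x-y+y≈x x y = trans (+-assoc x (- y) y) (trans (+-congˡ (-‿inverseˡ y)) (+-identityʳ x))

    0≤-⇒≤ : ∀ {x y} → 0# ≤ y - x → x ≤ y
    0≤-⇒≤ {x} {y} = ≤-respˡ-≈ (+-identityˡ x) ∘ ≤-respʳ-≈ (x-y+y≈x y x) ∘ +-monoˡ-≤ x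

    +-monoʳ-≤ : ∀ z {x y} → x ≤ y → z + x ≤ z + y
    +-monoʳ-≤ z {x} {y} = ≤-respˡ-≈ (+-comm x z) ∘ ≤-respʳ-≈ (+-comm y z) ∘ +-monoˡ-≤ z

    *-monoʳ-≤ : ∀ {z x y} → 0# ≤ z → x ≤ y → z * x ≤ z * y
    *-monoʳ-≤ {z} {x} {y} 0≤z = 0≤-⇒≤ ∘ ≤-respʳ-≈ (x[y-z]≈xy-xz z y x) ∘ *-nonNegative 0≤z ∘ ≤⇒0≤-

    *-monoˡ-≤ : ∀ {z x y} → 0# ≤ z → x ≤ y → x * z ≤ y * z
    *-monoˡ-≤ {z} {x} {y} 0≤z = ≤-respˡ-≈ (*-comm z x) ∘ ≤-respʳ-≈ (*-comm z y) ∘ *-monoʳ-≤ 0≤z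

    0≤1 : 0# ≤ 1#
    0≤1 with 0# ≤? 1#
    ... | yes 0≤1 = 0≤1
    ... | no  0≰1 = contradiction (≤-respʳ-≈ -1*-1≈1 (*-nonNegative 0≤-1 0≤-1)) 0≰1
      where
      0≤-1 : 0# ≤ - 1#
      0≤-1 = ≤-respʳ-≈ (+-identityˡ (- 1#)) (≤⇒0≤- (≰⇒≥ 0≰1))
      -1*-1≈1 : - 1# * - 1# ≈ 1#
      -1*-1≈1 = trans (sym (-‿distribˡ-* 1# (- 1#)))
                      (trans (-‿cong (*-identityˡ (- 1#))) (-‿involutive 1#))

    positive⇒≉0 : ∀ {x} → 0# < x → ¬ x ≈ 0#
    positive⇒≉0 (_ , 0≉x) = 0≉x ∘ sym

    ⁻¹-nonNegative : ∀ {x} → 0# < x → 0# ≤ x ⁻¹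
    ⁻¹-nonNegative {x} 0<x with 0# ≤? x ⁻¹
    ... | yes p = p
    ... | no  p = contradiction
      (antisym 0≤1 (≤-respˡ-≈ (*-inverseʳ (positive⇒≉0 0<x))
        (≤-respʳ-≈ (zeroʳ x) (*-monoʳ-≤ (proj₁ 0<x) (≰⇒≥ p)))))
      0≉1

    module _ {b : Carrier} (1<b : 1# < b) where

      0≤b-1 : 0# ≤ b - 1#
      0≤b-1 = ≤⇒0≤- (proj₁ 1<b)

      0<b-1 : 0# < b - 1#
      0<b-1 = 0≤b-1 , λ 0≈b-1 → <⇒≱ 1<b
        (≤-reflexive (trans (sym (x-y+y≈x b 1#)) (trans (+-congʳ (sym 0≈b-1)) (+-identityˡ 1#))))

      mutual
        ^-step : ∀ k → (b - 1#) + b ^ k ≤ b ^ suc k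
        ^-step k = ≤-respʳ-≈
          (trans (+-congˡ (sym (*-identityˡ (b ^ k))))
            (trans (sym (distribʳ (b ^ k) (b - 1#) 1#)) (*-congʳ (x-y+y≈x b 1#))))
          (+-monoˡ-≤ (b ^ k) (≤-respˡ-≈ (*-identityʳ (b - 1#)) (*-monoʳ-≤ 0≤b-1 (1≤^ k))))

        1≤^ : ∀ k → 1# ≤ b ^ k
        1≤^ zero    = ≤-refl
        1≤^ (suc k) = ≤-trans (1≤^ k) (^-≤-suc k)

        ^-≤-suc : ∀ k → b ^ k ≤ b ^ suc k
        ^-≤-suc k = ≤-trans (≤-respˡ-≈ (+-identityˡ (b ^ k)) (+-monoˡ-≤ (b ^ k) 0≤b-1)) (^-step k)

      ^-monoʳ-≤ : ∀ j k → j ℕ.≤′ k → b ^ j ≤ b ^ k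
      ^-monoʳ-≤ j k       (ℕ.≤′-reflexive ≡.refl) = ≤-refl
      ^-monoʳ-≤ j (suc k) (ℕ.≤′-step j≤k)         = ≤-trans (^-monoʳ-≤ j k j≤k) (^-≤-suc k)

      ^-cancelʳ-≤ : ∀ j k → b ^ j ≤ b ^ k → j ℕ.≤ k
      ^-cancelʳ-≤ j k bʲ≤bᵏ with j ℕ.≤? k
      ... | yes j≤k = j≤k
      ... | no  j≰k = contradiction (0≤-⇒≤ (≤-respʳ-≈ -[b-1]≈1-b (≤⇒0≤- b-1≤0))) (<⇒≱ 1<b)
        where
        b-1+bᵏ≤bᵏ : (b - 1#) + b ^ k ≤ b ^ k
        b-1+bᵏ≤bᵏ = ≤-trans (^-step k) (≤-trans (^-monoʳ-≤ (suc k) j (ℕ.≤⇒≤′ (ℕ.≰⇒> j≰k))) bʲ≤bᵏ)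
        b-1≤0 : b - 1# ≤ 0#
        b-1≤0 = ≤-respˡ-≈
          (trans (+-assoc _ _ _) (trans (+-congˡ (-‿inverseʳ (b ^ k))) (+-identityʳ _)))
          (≤-respʳ-≈ (-‿inverseʳ (b ^ k)) (+-monoˡ-≤ (- (b ^ k)) b-1+bᵏ≤bᵏ))
        -[b-1]≈1-b : 0# - (b - 1#) ≈ 1# - b
        -[b-1]≈1-b = trans (+-identityˡ _) (⁻¹-anti-homo‿- b 1#)
          where open import Algebra.Properties.AbelianGroup
                  (CommutativeRing.+-abelianGroup commutativeRing) using (⁻¹-anti-homo‿-)

      bernoulli-≤ : ∀ k → fromℕ k * (b - 1#) ≤ b ^ k
      bernoulli-≤ zero    = ≤-respˡ-≈ (sym (zeroˡ (b - 1#))) 0≤1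
      bernoulli-≤ (suc k) = ≤-respˡ-≈
        (sym (trans (distribʳ (b - 1#) 1# (fromℕ k)) (+-congʳ (*-identityˡ (b - 1#)))))
        (≤-trans (+-monoʳ-≤ (b - 1#) (bernoulli-≤ k)) (^-step k))

    ⌈⌉-spec : ∀ x → x ≤ fromℕ ⌈ x ⌉
    ⌈⌉-spec x = least-satisfies (λ k → x ≤? fromℕ k) (proj₁ (archimedean x)) (proj₂ (archimedean x))

    ⌈log⌉-spec : ∀ {b} → 1# < b → ∀ x → x ≤ b ^ ⌈log b ⌉ x
    ⌈log⌉-spec {b} 1<b x = least-satisfies (λ k → x ≤? b ^ k) k
      (≤-trans (≤-respˡ-≈ x/[b-1]*[b-1]≈x (*-monoˡ-≤ (0≤b-1 1<b) (proj₂ (archimedean _))))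
               (bernoulli-≤ 1<b k))
      where
      k = proj₁ (archimedean (x / (b - 1#)))
      x/[b-1]*[b-1]≈x : x / (b - 1#) * (b - 1#) ≈ x
      x/[b-1]*[b-1]≈x = trans (*-assoc _ _ _) (trans (*-congˡ (trans (*-comm _ _)
        (*-inverseʳ (positive⇒≉0 (0<b-1 1<b))))) (*-identityʳ x))

    grid-spec : ∀ {b} → 0# < b → b < 1# → ∀ {lo} → 0# < lo → ∀ {hi} z →
                let x = b ^ℤ (ℤ.- z) in lo ≤ x → x ≤ hi → x ∈ˡ grid b lo hi
    grid-spec {b} 0<b b<1 {lo} 0<lo {hi} z lo≤x x≤hi =
      ∈-filter⁺ (λ x → (lo ≤? x) ×-dec (x ≤? hi)) (∈-map⁺ _ (z∈exponents z lo≤x x≤hi)) (lo≤x , x≤hi)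
      where
      A = ⌈log b ⁻¹ ⌉ (lo ⁻¹)
      B = ⌈log b ⁻¹ ⌉ hi

      bb⁻¹≈1 : b * b ⁻¹ ≈ 1#
      bb⁻¹≈1 = *-inverseʳ (positive⇒≉0 0<b)

      1<b⁻¹ : 1# < b ⁻¹
      1<b⁻¹ = ≰⇒> λ b⁻¹≤1 → <⇒≱ b<1
        (≤-respˡ-≈ bb⁻¹≈1 (≤-respʳ-≈ (*-identityʳ b) (*-monoʳ-≤ (proj₁ 0<b) b⁻¹≤1)))

      1^k≈1 : ∀ k → 1# ^ k ≈ 1#
      1^k≈1 zero    = refl
      1^k≈1 (suc k) = trans (*-identityˡ _) (1^k≈1 k)

      ^-congˡ′ : ∀ k {x y} → x ≈ y → x ^ k ≈ y ^ k
      ^-congˡ′ k = Exp.^-congˡ k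
        where import Algebra.Properties.Semiring.Exp (CommutativeRing.semiring commutativeRing) as Exp

      b⁻ᵏbᵏ⁺¹≈b : ∀ k → (b ⁻¹) ^ k * b ^ suc k ≈ b
      b⁻ᵏbᵏ⁺¹≈b k = trans (*-congˡ (*-comm b (b ^ k))) (trans (sym (*-assoc _ _ _)) (trans
        (*-congʳ (trans (*-comm _ _) (trans (sym (^-distrib-* b (b ⁻¹) k))
          (trans (^-congˡ′ k bb⁻¹≈1) (1^k≈1 k))))) (*-identityˡ b)))

      0≤^ : ∀ k → 0# ≤ b ^ k
      0≤^ zero    = 0≤1
      0≤^ (suc k) = *-nonNegative (proj₁ 0<b) (0≤^ k)

      ^ℤ-neg : ∀ k → b ^ℤ (ℤ.- (+ k)) ≡ (b ⁻¹) ^ k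
      ^ℤ-neg zero    = ≡.refl
      ^ℤ-neg (suc k) = ≡.refl

      z∈exponents : ∀ z → lo ≤ b ^ℤ (ℤ.- z) → b ^ℤ (ℤ.- z) ≤ hi → z ∈ˡ exponents b lo hi
      z∈exponents (+ k) _ x≤hi = ∈-++⁺ˡ (∈-map⁺ +_ (∈-upTo⁺ (ℕ.s≤s (^-cancelʳ-≤ 1<b⁻¹ k B
        (≤-trans (≡.subst (_≤ hi) (^ℤ-neg k) x≤hi) (⌈log⌉-spec 1<b⁻¹ hi))))))
      z∈exponents -[1+ k ] lo≤x _ = ∈-++⁺ʳ (map +_ (upTo (suc B))) (∈-map⁺ -[1+_] (∈-upTo⁺ (ℕ.≰⇒> λ a≤k → <⇒≱ b<1
        (≤-trans (≤-respˡ-≈ (trans (*-comm _ _) (*-inverseʳ (positive⇒≉0 0<lo)))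
                            (*-monoʳ-≤ (⁻¹-nonNegative 0<lo) lo≤x))
        (≤-respʳ-≈ (b⁻ᵏbᵏ⁺¹≈b k) (*-monoˡ-≤ (0≤^ (suc k))
          (≤-trans (⌈log⌉-spec 1<b⁻¹ (lo ⁻¹)) (^-monoʳ-≤ 1<b⁻¹ A k (ℕ.≤⇒≤′ a≤k)))))))))

module ParallelKnapsack (F : ArchimedeanOrderedField) where

  open Field F public

  half : Carrier
  half = (1# + 1#) ⁻¹

  -- Finitely supported probability distributions, as weighted lists.
  Distribution : Set → Set
  Distribution A = List (Carrier × A)

  uniform : {A : Set} → List A → Distribution A
  uniform xs = map (fromℕ (length xs) ⁻¹ ,_) xs

  -- Branches of probability zero are dropped: they are not executions.
  bernoulli : Carrier → Distribution Bool
  bernoulli p = filter (λ o → 0# <? proj₁ o) ((p , true) ∷ (1# - p , false) ∷ [])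

  insertions : {A : Set} → A → List A → List (List A)
  insertions x []       = [ [ x ] ]
  insertions x (y ∷ ys) = (x ∷ y ∷ ys) ∷ map (y ∷_) (insertions x ys)

  permutations : {A : Set} → List A → List (List A)
  permutations []       = [ [] ]
  permutations (x ∷ xs) = concatMap (insertions x) (permutations xs)

  _≟ˢ_ : ∀ {n} → DecidableEquality (Subset n)
  _≟ˢ_ = Vec.≡-dec Bool._≟_

  -- Randomised programs whose only access to f is `ask`: one adaptive round
  -- querying all sets in a list.  Its result is a table of the answers, which
  -- reads 0 on every set that was not queried.
  data Prog (n : ℕ) : Set → Set₁ where
    ret   : {A : Set} → A → Prog n A
    _>>=_ : {A B : Set} → Prog n A → (A → Prog n B) → Prog n B
    ask   : List (Subset n) → Prog n (Subset n → Carrier)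
    draw  : {A : Set} → Distribution A → Prog n A
    while : {S : Set} → (S → Bool) → (S → Prog n S) → S → Prog n S
    par   : {A : Set} → List (Prog n A) → Prog n (List A)

  infixl 1 _>>=_

  table : ∀ {n} → List (Subset n) → (Subset n → Carrier) → Subset n → Carrier
  table Q f X = if does (any? (X ≟ˢ_) Q) then f X else 0#

  -- One possible execution.  The trace lists the number of queries made in each
  -- successive adaptive round.
  record Outcome (A : Set) : Set where
    constructor outcome
    field
      weight : Carrier
      value  : A
      trace  : List ℕ

    rounds queries : ℕ
    rounds  = length trace
    queries = sum trace

  open Outcome public

  after : {A B : Set} → Outcome A → Outcome B → Outcome B
  after o o′ = outcome (weight o * weight o′) (value o′) (trace o ++ trace o′)

  -- Independent executions side by side: their k-th rounds are merged into one.
  beside : {A : Set} → Outcome A → Outcome (List A) → Outcome (List A)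
  beside o os = outcome (weight o * weight os) (value o ∷ value os)
                        (alignWith (These.fold id id ℕ._+_) (trace o) (trace os))

  -- f ⊢ P ⇓ D : with oracle f, every execution of P terminates, and D lists
  -- their outcomes.
  infix 3 _⊢_⇓_

  data _⊢_⇓_ {n} (f : Subset n → Carrier) : {A : Set} → Prog n A → List (Outcome A) → Set₁ where

    ⇓ret : ∀ {A} {a : A} → f ⊢ ret a ⇓ [ outcome 1# a [] ]

    ⇓bind : ∀ {A B} {P : Prog n A} {k : A → Prog n B} {D Es} →
            f ⊢ P ⇓ D → Pointwise (λ o E → f ⊢ k (value o) ⇓ E) D Es →
            f ⊢ P >>= k ⇓ concat (zipWith (λ o E → map (after o) E) D Es)

    ⇓ask : ∀ {Q} → f ⊢ ask Q ⇓ [ outcome 1# (table Q f) [ length Q ] ]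

    ⇓draw : ∀ {A} {d : Distribution A} → f ⊢ draw d ⇓ map (λ (w , a) → outcome w a []) d

    ⇓stop : ∀ {S} {test : S → Bool} {body s} → test s ≡ false →
            f ⊢ while test body s ⇓ [ outcome 1# s [] ]

    ⇓loop : ∀ {S} {test : S → Bool} {body s D} → test s ≡ true →
            f ⊢ body s >>= while test body ⇓ D → f ⊢ while test body s ⇓ D

    ⇓par : ∀ {A} {Ps : List (Prog n A)} {Ds} → Pointwise (f ⊢_⇓_) Ps Ds →
           f ⊢ par Ps ⇓ foldr (cartesianProductWith beside) [ outcome 1# [] [] ] Ds

  𝔼 : {A : Set} → List (Outcome A) → (A → Carrier) → Carrier
  𝔼 D g = Σ[ D ] (λ o → weight o * g (value o))

  -- The adaptive complexity of P with oracle f is at most R and its query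
  -- complexity at most Q, over all executions.  In particular no round makes
  -- more than Q queries.
  Complexity≤ : ∀ {n A} → (Subset n → Carrier) → Prog n A → ℕ → ℕ → Set₁
  Complexity≤ f P R Q = ∃ λ D → f ⊢ P ⇓ D × All (λ o → rounds o ℕ.≤ R × queries o ℕ.≤ Q) D

  elements : ∀ {n} → Subset n → List (Fin n)
  elements X = filter (_∈? X) (allFin _)

  fromList : ∀ {n} → List (Fin n) → Subset n
  fromList vs = ⋃ (map ⁅_⁆ vs)

  ⟪_⟫ : ∀ {n} {P : Pred (Fin n) 0ℓ} → Decidable P → Subset n
  ⟪ P? ⟫ = Vec.tabulate (does ∘ P?)

  marginal : ∀ {n} → (Subset n → Carrier) → Fin n → Subset n → Carrier
  marginal f u X = f (X ∪ ⁅ u ⁆) - f X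

  NonNegative Submodular : ∀ {n} → (Subset n → Carrier) → Set
  NonNegative f = ∀ X → 0# ≤ f X
  Submodular  f = ∀ X Y → f (X ∪ Y) + f (X ∩ Y) ≤ f X + f Y

  cost : ∀ {n} → (Fin n → Carrier) → Subset n → Carrier
  cost c X = Σ[ elements X ] c

  IsMaxFeasibleSize : ∀ {n} → (Fin n → Carrier) → Carrier → ℕ → Set
  IsMaxFeasibleSize c B r = (∃ λ X → cost c X ≤ B × ∣ X ∣ ≡ r) × (∀ X → cost c X ≤ B → ∣ X ∣ ℕ.≤ r)

  -- The constant hidden in both bounds on usm is K, and log (1/ε) is rounded up.
  IsUSM : Carrier → ℕ → (∀ {n} → Subset n → Prog n (Subset n)) → Set₁
  IsUSM ε K usm = ∀ {n} (f : Subset n → Carrier) → NonNegative f → Submodular f → ∀ X →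
    ∃ λ D → f ⊢ usm X ⇓ D
      × All (λ o → value o ⊆ X
                 × fromℕ (rounds o) ≤ fromℕ K * (ε ⁻¹ * ℓ)
                 × fromℕ (queries o) ≤ fromℕ K * (fromℕ n / ε ^ 4 * ℓ ^ 3)) D
      × (∀ Y → Y ⊆ X → (half - ε) * f Y ≤ 𝔼 D f)
    where
    ℓ : Carrier
    ℓ = fromℕ (⌈log (1# + 1#) ⌉ (ε ⁻¹))

  data Search : Set where
    exhaustive binary : Search

  module Algorithm {n} (usm : Subset n → Prog n (Subset n)) (search : Search)
                   (ε B : Carrier) (c : Fin n → Carrier) where

    feasible? : ∀ X → Dec (cost c X ≤ B)
    feasible? X = cost c X ≤? B

    getSEQ : Subset n → Subset n → Prog n (List (Fin n))
    getSEQ A L₀ = while (λ (V , L) → does (nonempty? L)) body ([] , L₀) >>= λ (V , _) → ret V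
      where
      body : List (Fin n) × Subset n → Prog n (List (Fin n) × Subset n)
      body (V , L) = do
        vs ← draw (uniform (permutations (elements L)))
        let s  = greatest (λ i → feasible? (A ∪ fromList V ∪ fromList (take i vs))) (length vs)
            V′ = V ++ take s vs
        ret (V′ , ⟪ (λ u → u ∈? (L ─ fromList V′) ×-dec feasible? (A ∪ fromList V′ ∪ ⁅ u ⁆)) ⟫)

    -- The least i ≤ d at which the probe succeeds, provided that it succeeds at d
    -- and at everything above an index where it succeeds.
    bisect : (ℕ → Prog n Bool) → ℕ → Prog n ℕ
    bisect probe d = while (λ (lo , hi) → lo ℕ.<ᵇ hi) body (0 , d) >>= λ (lo , _) → ret lo
      where
      body : ℕ × ℕ → Prog n (ℕ × ℕ)
      body (lo , hi) = do
        let mid = ⌊ lo ℕ.+ hi /2⌋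
        b ← probe mid
        ret (if b then (lo , mid) else (suc mid , hi))

    -- g stands for the table of queried values of f.
    module Thresholds (ρ : Carrier) (A L : Subset n) (V : List (Fin n)) where

      d : ℕ
      d = length V

      G : ℕ → Subset n
      G i = A ∪ fromList (take i V)

      E⁺ E⁻ : (Subset n → Carrier) → ℕ → Subset n
      E⁺ g i = ⟪ (λ u → u ∈? L ×-dec (ρ ≤? marginal g u (G i) / c u) ×-dec feasible? (G i ∪ ⁅ u ⁆)) ⟫
      E⁻ g i = ⟪ (λ u → u ∈? L ×-dec (marginal g u (G i) <? 0#)) ⟫

      -- vⱼ ∈ Dᵢ is represented by the pair (j - 1 , vⱼ).
      D : (Subset n → Carrier) → ℕ → List (ℕ × Fin n)
      D g i = filter (λ (j , v) → marginal g v (G j) <? 0#) (take i (zip (upTo d) V))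

      shrinks? : ∀ g → Decidable (λ i → cost c (E⁺ g i) ≤ (1# - ε) * cost c L)
      shrinks? g i = _ ≤? _

      loses? : ∀ g → Decidable (λ i →
        ε * Σ[ elements (E⁺ g i) ] (λ u → marginal g u (G i)) ≤
        Σ[ elements (E⁻ g i) ] (λ u → abs (marginal g u (G i))) +
        Σ[ D g i ] (λ (j , v) → abs (marginal g v (G j))))
      loses? g i = _ ≤? _

      -- The queries needed to evaluate the above at all i in is, where i ≤ m.
      sets : ℕ → List ℕ → List (Subset n)
      sets m is = map G (upTo (suc m)) ++ concatMap (λ i → map (λ u → G i ∪ ⁅ u ⁆) (elements L)) is

      probe : {P : (Subset n → Carrier) → Pred ℕ 0ℓ} → (∀ g → Decidable (P g)) → ℕ → Prog n Bool
      probe P? i = ask (sets i [ i ]) >>= λ g → ret (does (P? g i))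

      thresholds : Search → Prog n (ℕ × ℕ)
      thresholds exhaustive = do
        g ← ask (sets d (upTo (suc d)))
        ret (least (shrinks? g) d , least (loses? g) d)
      thresholds binary = do
        t₁ ← bisect (probe shrinks?) d
        t₂ ← bisect (probe loses?) d
        ret (t₁ , t₂)

    open Thresholds using (thresholds)

    dense : Carrier → Subset n → Subset n → Prog n (Subset n)
    dense ρ A L = do
      g ← ask (A ∷ map (λ u → A ∪ ⁅ u ⁆) (elements L))
      ret ⟪ (λ u → u ∈? L ×-dec (ρ ≤? marginal g u A / c u) ×-dec feasible? (A ∪ ⁅ u ⁆)) ⟫

    record State : Set where
      constructor state
      field
        A U   : Subset n
        count : ℕ
        L     : Subset n

    randBatch : Carrier → Subset n → ℕ → Carrier → Prog n (Subset n × Subset n × Subset n)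
    randBatch ρ I M p = do
      L₀ ← dense ρ ⊥ I
      state A U _ L ← while running step (state ⊥ ⊥ 0 L₀)
      ret (A , U , L)
      where
      running : State → Bool
      running (state _ _ count L) = does (nonempty? L ×-dec count ℕ.<? M)

      step : State → Prog n State
      step (state A U count L) = do
        V ← getSEQ A L
        (t₁ , t₂) ← thresholds ρ A L V search
        let V* = fromList (take (t₁ ℕ.⊓ t₂) V)
            U′ = U ∪ V*
        heads ← draw (bernoulli p)
        let A′     = if heads then A ∪ V* else A
            count′ = if heads then (if does (t₂ ℕ.<? t₁) then suc count else count) else count
        L′ ← dense ρ A′ (L ─ U′)
        ret (state A′ U′ count′ L′)

    probe : Carrier → Subset n → Subset n → Prog n (Subset n)
    probe ρ N₁ N₂ = do
      (A₁ , _ , _) ← randBatch ρ N₁ M 1#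
      (A₂ , _ , _) ← randBatch ρ (N₁ ─ A₁) M 1#
      T₁ ← improve ⊥ A₁
      T₂ ← improve T₁ A₂
      if does (feasible? (N₂ ∪ A₁))
        then (do A₃ ← usm (N₂ ∪ A₁)
                 g  ← ask (T₂ ∷ A₃ ∷ [])
                 ret (argmax g T₂ [ A₃ ]))
        else ret T₂
      where
      M : ℕ
      M = ⌈ (ε ^ 2) ⁻¹ ⌉

      improve : Subset n → Subset n → Prog n (Subset n)
      improve T A = do
        let candidates = filter (λ u → feasible? (A ∪ ⁅ u ⁆)) (elements N₁)
        g ← ask (T ∷ A ∷ map (λ u → A ∪ ⁅ u ⁆) candidates)
        ret (argmax g T (A ∷ extension g candidates))
        where
        extension : (Subset n → Carrier) → List (Fin n) → List (Subset n)
        extension g []       = []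
        extension g (u ∷ us) = [ A ∪ ⁅ argmax (λ v → g (A ∪ ⁅ v ⁆)) u us ⁆ ]

    parSKP : Carrier → Prog n (Subset n)
    parSKP α = ask (map ⁅_⁆ (allFin n)) >>= λ g → go g (allFin n)
      where
      N₁ N₂ : Subset n
      N₁ = ⟪ (λ u → ε * B / fromℕ n <? c u) ⟫
      N₂ = ∁ N₁

      -- log_{1-ε} ε is the logarithm of ε⁻¹ to the base (1-ε)⁻¹.
      repetitions : ℕ
      repetitions = ⌈log (1# - ε) ⁻¹ ⌉ (ε ⁻¹)

      go : (Subset n → Carrier) → List (Fin n) → Prog n (Subset n)
      go g []       = ret ⊥
      go g (u ∷ us) = do
        let u*   = argmax (λ v → g ⁅ v ⁆) u us
            ρmin = α * g ⁅ u* ⁆ / B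
            ρmax = fromℕ n ^ 2 * α * g ⁅ u* ⁆ / (ε * B)
            Z    = grid (1# - ε) ρmin ρmax
        Y ← usm N₂
        h ← ask (Y ∷ ⁅ u* ⁆ ∷ [])
        let S = argmax h Y [ ⁅ u* ⁆ ]
        Ts ← par (concatMap (λ ρ → replicate repetitions (probe ρ N₁ N₂)) Z)
        k ← ask (S ∷ Ts)
        ret (argmax k S Ts)

  -- log k up to a factor of 2 for k ≥ 2, and positive at k = 1, where a bound
  -- by log 1 = 0 would fail.
  lg : ℕ → ℕ
  lg k = suc ⌊log₂ k ⌋

{-# OPTIONS --safe #-}

-- The sequence returned by GetSEQ saturates the budget, so E⁺ is empty at its last index.  Hence
-- either implementation of the search for t₁ returns an index at which c(E⁺) ≤ (1 - ε) c(L), and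
-- nothing needs to be known about t₂.  So each iteration of RandBatch either increments count,
-- which happens at most ⌈ε⁻²⌉ times, or shrinks c(L) by the factor 1 - ε.  Since L ⊆ 𝒩₁ is
-- nonempty, ε B / n < c(L) ≤ n B, so the latter happens O(log (n² / ε)) = O(log n) times.  The
-- same ratio n² / ε = ρmax / ρmin bounds the number of thresholds in Z.
-- One iteration costs O(1) rounds and O(n r) queries, or O(log r) rounds and O(n log r) queries,
-- because the sequences have length at most r.

module Submission where

open import Defs
open import Algebra.Bundles using (CommutativeRing)
open import Data.Bool.Base using (Bool; true; false; if_then_else_)
open import Data.Fin.Base using (Fin)
open import Data.Fin.Subset using (Subset; ⊥; _∈_; _∉_; _⊆_; _∪_; _─_; ⁅_⁆; _⊂_; ∣_∣; Nonempty)
open import Data.Fin.Subset.Properties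
  using (_∈?_; nonempty?; ∉⊥; x∈⁅x⁆; x∈⁅y⁆⇒x≡y; p⊂q⇒∣p∣<∣q∣; p⊆q⇒∣p∣≤∣q∣; ∣p∣≤n; p⊆p∪q; q⊆p∪q; x∈p∪q⁻;
         x∈p∪q⁺; p─q⊆p; x∈p∧x∉q⇒x∈p─q; ⊆-antisym; ⊆-min)
open import Data.Integer.Base as ℤ using (ℤ; +_; -[1+_])
open import Data.List.Base
  using (List; []; _∷_; [_]; _++_; map; concat; concatMap; filter; foldr; length; take;
         zipWith; replicate; upTo; applyUpTo; allFin; alignWith; cartesianProductWith)
open import Data.List.Membership.Propositional using () renaming (_∈_ to _∈ˡ_)
open import Data.List.Membership.Propositional.Properties
  using (∈-cartesianProductWith⁻; ∈-map⁺; ∈-filter⁺; ∈-filter⁻; ∈-++⁺ˡ; ∈-++⁺ʳ; ∈-++⁻; ∈-upTo⁺;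
         ∈-allFin; ∈-concatMap⁺)
open import Data.List.Properties
  using (length-++; length-map; map-id; length-filter; length-upTo; length-tabulate;
         length-replicate; take-all; map-++; map-∘; take++drop≡id; map-upTo; filter-++; filter-none)
open import Data.List.Relation.Binary.Permutation.Propositional as ↭ using (_↭_)
open import Data.List.Relation.Binary.Permutation.Propositional.Properties
  using (∈-resp-↭)
import Data.List.Relation.Binary.Permutation.Setoid.Properties as Permutationₛ
open import Data.List.Relation.Binary.Pointwise.Base using (Pointwise; []; _∷_)
open import Data.List.Relation.Unary.All as All using (All; []; _∷_)
import Data.List.Relation.Unary.All.Properties as All
open import Data.List.Relation.Unary.Any as Any using (any?; here; there)
open import Data.List.Relation.Unary.Unique.Propositional using (Unique; []; _∷_)
import Data.List.Relation.Unary.Unique.Propositional.Properties as Unique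
open import Data.Nat.Base as ℕ using (ℕ; zero; suc; NonZero; z≤n; s≤s; ⌊_/2⌋)
open import Data.Nat.ListAction using (sum)
open import Data.Nat.ListAction.Properties using (sum-++)
open import Data.Nat.Logarithm using (⌊log₂_⌋; ⌊log₂⌋-mono-≤; ⌊log₂[2^n]⌋≡n)
import Data.Nat.Properties as ℕ
open import Data.Nat.Tactic.RingSolver using (solve-∀)
open import Data.Product.Base using (∃; _×_; _,_; proj₁; proj₂)
open import Data.Sum.Base using (_⊎_; inj₁; inj₂; [_,_]′)
import Data.These.Base as These
open import Data.Unit.Base using (⊤; tt)
import Data.Vec.Properties as Vec
open import Function.Base using (_∘_; id; case_of_)
open import Level using (0ℓ)
open import Relation.Binary.Bundles using (TotalOrder)
open import Relation.Binary.Structures using (IsDecTotalOrder)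
import Relation.Binary.Reasoning.PartialOrder as PartialOrderReasoning
open import Relation.Binary.PropositionalEquality as ≡ using (_≡_; refl)
open import Relation.Nullary using (¬_; Dec; yes; no; does; contradiction; _×-dec_)
open import Relation.Nullary.Decidable using (dec-true)
open import Relation.Unary using (Pred; Decidable)

-- The complexities are worst cases over all executions, so the proof is a program logic: `Within`
-- bounds rounds and queries of every outcome and carries a postcondition, since later bounds depend
-- on earlier results. A loop invariant is indexed by the number of iterations still allowed, so
-- termination and cost come from one induction. Two obstacles shape the rest. The programs see
-- tables that agree with `f` only on the sets asked; a search is therefore specified by the true
-- `f` at the index `t₁` it returns, and answers are transferred between table and `f` only at
-- indices that were queried. And the two searches differ in price; so one search is taken as the
-- unit, `θR` rounds and `θQ` queries, and everything up to a run of `probe` is counted in units.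
-- The two halves of the theorem are one computation with two units: 1 round and `4 n r` queries, or
-- `2 lg r` rounds and `6 n lg r` queries. Logarithms to the base `β = (1 - ε) ⁻¹` appear only as
-- natural exponents: `levels n`, at most a constant times `lg n`, satisfies
-- `n² / ε ≤ β ^ levels n`.

merge : List ℕ → List ℕ → List ℕ
merge = alignWith (These.fold id id ℕ._+_)

-- Side by side, rounds combine by maximum while queries add up. This is why running all thresholds
-- in parallel does not multiply the adaptivity.
length-merge : ∀ {m} xs ys → length xs ℕ.≤ m → length ys ℕ.≤ m → length (merge xs ys) ℕ.≤ m
length-merge {m} []       ys       _       q       = ≡.subst (ℕ._≤ m) (≡.sym (length-map _ ys)) q
length-merge {m} (x ∷ xs) []       p       _       = ≡.subst (ℕ._≤ m) (≡.sym (length-map _ (x ∷ xs))) p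
length-merge (x ∷ xs) (y ∷ ys) (s≤s p) (s≤s q) = s≤s (length-merge xs ys p q)

sum-merge : ∀ xs ys → sum (merge xs ys) ≡ sum xs ℕ.+ sum ys
sum-merge []       ys       = ≡.cong sum (map-id ys)
sum-merge (x ∷ xs) []       = ≡.trans (≡.cong sum (map-id (x ∷ xs))) (≡.sym (ℕ.+-identityʳ _))
sum-merge (x ∷ xs) (y ∷ ys) =
  ≡.trans (≡.cong (x ℕ.+ y ℕ.+_) (sum-merge xs ys)) (ℕ-interchange x y (sum xs) (sum ys))
  where
  open import Algebra.Properties.CommutativeSemigroup ℕ.+-commutativeSemigroup
    renaming (interchange to ℕ-interchange)

-- A program logic for worst-case rounds and queries.

module Executions (F : ArchimedeanOrderedField) where

  open ParallelKnapsack F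

  record Bounded {A : Set} (R Q : ℕ) (Φ : A → Set) (o : Outcome A) : Set where
    constructor bounded-by
    field
      rounds≤  : rounds o ℕ.≤ R
      queries≤ : queries o ℕ.≤ Q
      holds    : Φ (value o)
  open Bounded

  record Within {n} (f : Subset n → Carrier) {A : Set} (R Q : ℕ) (Φ : A → Set) (P : Prog n A)
         : Set₁ where
    constructor within
    field
      {outcomes} : List (Outcome A)
      execution  : f ⊢ P ⇓ outcomes
      bounded    : All (Bounded R Q Φ) outcomes

  module _ {n} {f : Subset n → Carrier} where

    weaken : ∀ {A R R′ Q Q′} {Φ Ψ : A → Set} {P : Prog n A} → R ℕ.≤ R′ → Q ℕ.≤ Q′ →
             (∀ {a} → Φ a → Ψ a) → Within f R Q Φ P → Within f R′ Q′ Ψ P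
    weaken R≤R′ Q≤Q′ Φ⊆Ψ (within e b) = within e
      (All.map (λ (bounded-by r q φ) → bounded-by (ℕ.≤-trans r R≤R′) (ℕ.≤-trans q Q≤Q′) (Φ⊆Ψ φ)) b)

    ret-within : ∀ {A} {Φ : A → Set} {a} → Φ a → Within f 0 0 Φ (ret a)
    ret-within φ = within ⇓ret (bounded-by z≤n z≤n φ ∷ [])

    ask-within : ∀ {Q} → Within f 1 (length Q) (_≡ table Q f) (ask Q)
    ask-within = within ⇓ask (bounded-by ℕ.≤-refl (ℕ.≤-reflexive (ℕ.+-identityʳ _)) refl ∷ [])

    draw-within : ∀ {A} {Φ : A → Set} {d : Distribution A} → All (Φ ∘ proj₂) d →
                  Within f 0 0 Φ (draw d)
    draw-within φs = within ⇓draw (All.map⁺ (All.map (bounded-by z≤n z≤n) φs))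

    after-bounded : ∀ {A B R₁ Q₁ R₂ Q₂ Φ} {Ψ : B → Set} {o : Outcome A} {o′} →
                    Bounded R₁ Q₁ Φ o → Bounded R₂ Q₂ Ψ o′ →
                    Bounded (R₁ ℕ.+ R₂) (Q₁ ℕ.+ Q₂) Ψ (after o o′)
    after-bounded {o = o} {o′} (bounded-by r₁ q₁ _) (bounded-by r₂ q₂ ψ) = bounded-by
      (≡.subst (ℕ._≤ _) (≡.sym (length-++ (trace o))) (ℕ.+-mono-≤ r₁ r₂))
      (≡.subst (ℕ._≤ _) (≡.sym (sum-++ (trace o) (trace o′))) (ℕ.+-mono-≤ q₁ q₂)) ψ

    bind-within : ∀ {A B R₁ Q₁ R₂ Q₂ Φ Ψ} {P : Prog n A} {k : A → Prog n B} →
                  Within f R₁ Q₁ Φ P → (∀ a → Φ a → Within f R₂ Q₂ Ψ (k a)) →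
                  Within f (R₁ ℕ.+ R₂) (Q₁ ℕ.+ Q₂) Ψ (P >>= k)
    bind-within {R₁ = R₁} {Q₁} {R₂} {Q₂} {Φ} {Ψ} {k = k} (within e b) w =
      let _ , es , bs = continue b in within (⇓bind e es) bs
      where
      continue : ∀ {D} → All (Bounded R₁ Q₁ Φ) D → ∃ λ Es →
                 Pointwise (λ o E → f ⊢ k (value o) ⇓ E) D Es ×
                 All (Bounded (R₁ ℕ.+ R₂) (Q₁ ℕ.+ Q₂) Ψ)
                     (concat (zipWith (λ o E → map (after o) E) D Es))
      continue []       = [] , [] , []
      continue (_∷_ {x = o} b bs) =
        let within e′ b′  = w (value o) (holds b)
            _ , es , bs′ = continue bs
        in  _ , e′ ∷ es , All.++⁺ (All.map⁺ (All.map (after-bounded b) b′)) bs′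

    -- The index of `Inv` bounds the iterations still to come: each one lowers it, and at zero the
    -- test must fail. The index on exit is existential because the loop may stop early.
    while-within : ∀ {S R Q test} {body : S → Prog n S} (Inv : ℕ → S → Set) →
                   (∀ s → Inv 0 s → ¬ test s ≡ true) →
                   (∀ k s → Inv (suc k) s → test s ≡ true → Within f R Q (Inv k) (body s)) →
                   ∀ k s → Inv k s →
                   Within f (k ℕ.* R) (k ℕ.* Q) (λ s → test s ≡ false × ∃ λ j → Inv j s)
                          (while test body s)
    while-within {test = test} Inv stops step k s inv with test s in eq
    ... | false = within (⇓stop eq) (bounded-by z≤n z≤n (eq , k , inv) ∷ [])
    while-within Inv stops step zero    s inv | true = contradiction eq (stops s inv)
    while-within Inv stops step (suc k) s inv | true =
      let within e b = bind-within (step k s inv eq) (while-within Inv stops step k)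
      in  within (⇓loop eq e) b

    beside-bounded : ∀ {A R Q Q′ m} {Φ : A → Set} {o : Outcome A} {os} →
                     Bounded R Q Φ o → Bounded R Q′ (λ vs → length vs ≡ m) os →
                     Bounded R (Q ℕ.+ Q′) (λ vs → length vs ≡ suc m) (beside o os)
    beside-bounded {o = o} {os} (bounded-by r q _) (bounded-by rs qs l) = bounded-by
      (length-merge (trace o) (trace os) r rs)
      (≡.subst (ℕ._≤ _) (≡.sym (sum-merge (trace o) (trace os))) (ℕ.+-mono-≤ q qs)) (≡.cong suc l)

    -- Only the number of results survives as postcondition; it determines the size of the final
    -- query over `S ∷ Ts`.
    par-within : ∀ {A R Q} {Φ : A → Set} {Ps : List (Prog n A)} → All (Within f R Q Φ) Ps →
                 Within f R (length Ps ℕ.* Q) (λ vs → length vs ≡ length Ps) (par Ps)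
    par-within {R = R} {Q} {Φ} ws = let _ , es , bs = go ws in within (⇓par es) bs
      where
      go : ∀ {Ps} → All (Within f R Q Φ) Ps → ∃ λ Ds → Pointwise (f ⊢_⇓_) Ps Ds ×
           All (Bounded R (length Ps ℕ.* Q) (λ vs → length vs ≡ length Ps))
               (foldr (cartesianProductWith beside) [ outcome 1# [] [] ] Ds)
      go []                = [] , [] , bounded-by z≤n z≤n refl ∷ []
      go (within {D} e b ∷ ws) =
        let Ds , es , bs = go ws in _ , e ∷ es , All.tabulate λ o∈ →
          let _ , _ , p , q , eq = ∈-cartesianProductWith⁻ beside D _ o∈
          in  ≡.subst (Bounded R _ _) (≡.sym eq) (beside-bounded (All.lookup b p) (All.lookup bs q))

-- Finite sets, sequences and bounded search.

module Finite (F : ArchimedeanOrderedField) where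

  open ParallelKnapsack F

  does⁻ : ∀ {P : Set} (P? : Dec P) → does P? ≡ true → P
  does⁻ (yes p) _ = p

  does-false⁻ : ∀ {P : Set} (P? : Dec P) → does P? ≡ false → ¬ P
  does-false⁻ (no ¬p) _ = ¬p

  least-≤ : {P : Pred ℕ 0ℓ} (P? : Decidable P) (b : ℕ) → least P? b ℕ.≤ b
  least-≤ P? zero    = z≤n
  least-≤ P? (suc b) with P? 0
  ... | yes _ = z≤n
  ... | no  _ = s≤s (least-≤ (P? ∘ suc) b)

  greatest-satisfies : {P : Pred ℕ 0ℓ} (P? : Decidable P) (b : ℕ) → P 0 → P (greatest P? b)
  greatest-satisfies P? zero    P0 = P0
  greatest-satisfies P? (suc b) P0 with P? (suc b)
  ... | yes P1+b = P1+b
  ... | no  _    = greatest-satisfies P? b P0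

  greatest-maximal : {P : Pred ℕ 0ℓ} (P? : Decidable P) (b : ℕ) →
                     ∀ {i} → P i → i ℕ.≤ b → i ℕ.≤ greatest P? b
  greatest-maximal P? zero    Pi i≤b = i≤b
  greatest-maximal P? (suc b) Pi i≤b with P? (suc b)
  ... | yes _   = i≤b
  ... | no ¬P1+b = greatest-maximal P? b Pi
    (ℕ.≤-pred (ℕ.≤∧≢⇒< i≤b λ { refl → ¬P1+b Pi }))

  -- Taking logarithms in the opposite inequality would give `lg n ≤ ⌊log₂ n ⌋`. The strictness
  -- leaves room for all the indices from 0 to `n` in a bracket of length `2 ^ lg n`.
  n<2^lg : ∀ n → n ℕ.< 2 ℕ.^ lg n
  n<2^lg n = ℕ.≰⇒> λ 2^lg≤n → ℕ.1+n≰n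
    (≡.subst (ℕ._≤ ⌊log₂ n ⌋) (⌊log₂[2^n]⌋≡n (lg n)) (⌊log₂⌋-mono-≤ 2^lg≤n))

  module _ {n} {P : Pred (Fin n) 0ℓ} (P? : Decidable P) where

    ∈-⟪⟫⁺ : ∀ {u} → P u → u ∈ ⟪ P? ⟫
    ∈-⟪⟫⁺ {u} Pu = Vec.lookup⇒[]= u _ (≡.trans (Vec.lookup∘tabulate _ u) (dec-true (P? u) Pu))

    ∈-⟪⟫⁻ : ∀ {u} → u ∈ ⟪ P? ⟫ → P u
    ∈-⟪⟫⁻ {u} u∈ = does⁻ (P? u) (≡.trans (≡.sym (Vec.lookup∘tabulate _ u)) (Vec.[]=⇒lookup u∈))

  module _ {n} {X : Subset n} where

    ∈-elements⁺ : ∀ {u} → u ∈ X → u ∈ˡ elements X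
    ∈-elements⁺ {u} = ∈-filter⁺ (_∈? X) (∈-allFin u)

    ∈-elements⁻ : ∀ {u} → u ∈ˡ elements X → u ∈ X
    ∈-elements⁻ = proj₂ ∘ ∈-filter⁻ (_∈? X) {xs = allFin n}

  elements-unique : ∀ {n} (X : Subset n) → Unique (elements X)
  elements-unique X = Unique.filter⁺ (_∈? X) (Unique.allFin⁺ _)

  length-elements : ∀ {n} (X : Subset n) → length (elements X) ℕ.≤ n
  length-elements {n} X =
    ℕ.≤-trans (length-filter (_∈? X) (allFin n)) (ℕ.≤-reflexive (length-tabulate id))

  ∈-fromList⁺ : ∀ {n} {u : Fin n} {vs} → u ∈ˡ vs → u ∈ fromList vs
  ∈-fromList⁺ (here refl) = x∈p∪q⁺ (inj₁ (x∈⁅x⁆ _))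
  ∈-fromList⁺ (there u∈)  = x∈p∪q⁺ (inj₂ (∈-fromList⁺ u∈))

  ∈-fromList⁻ : ∀ {n} {u : Fin n} vs → u ∈ fromList vs → u ∈ˡ vs
  ∈-fromList⁻ []       u∈ = contradiction u∈ ∉⊥
  ∈-fromList⁻ (v ∷ vs) u∈ with x∈p∪q⁻ ⁅ v ⁆ _ u∈
  ... | inj₁ u∈v  = here (x∈⁅y⁆⇒x≡y v u∈v)
  ... | inj₂ u∈vs = there (∈-fromList⁻ vs u∈vs)

  -- Feasibility bounds cardinalities, but the searches run along sequences; without repetitions the
  -- two sizes can be compared.
  length≤∣fromList∣ : ∀ {n} {vs : List (Fin n)} → Unique vs → length vs ℕ.≤ ∣ fromList vs ∣
  length≤∣fromList∣ []               = z≤n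
  length≤∣fromList∣ {vs = v ∷ vs} (v∉ ∷ u) = ℕ.≤-<-trans (length≤∣fromList∣ u)
    (p⊂q⇒∣p∣<∣q∣ (q⊆p∪q ⁅ v ⁆ _ , v , x∈p∪q⁺ (inj₁ (x∈⁅x⁆ v)) ,
      λ v∈ → All.lookup v∉ (∈-fromList⁻ vs v∈) refl))

  ∈-─⁻ : ∀ {n} {u : Fin n} {X Y : Subset n} → u ∈ X ─ Y → u ∈ X × u ∉ Y
  ∈-─⁻ {X = X} {Y} u∈ = p─q⊆p X Y u∈ , disjoint X Y u∈
    where
    open import Data.Vec.Base using (_∷_; here; there)
    disjoint : ∀ {n} {u : Fin n} (X Y : Subset n) → u ∈ X ─ Y → u ∉ Y
    disjoint (_ ∷ _) (true ∷ _) ()         here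
    disjoint (_ ∷ X) (_ ∷ Y)    (there u∈) (there u∈Y) = disjoint X Y u∈ u∈Y

  insertions-↭ : ∀ {A : Set} (x : A) ys → All (_↭ x ∷ ys) (insertions x ys)
  insertions-↭ x []       = ↭.refl ∷ []
  insertions-↭ x (y ∷ ys) = ↭.refl ∷ All.map⁺
    (All.map (λ zs↭ → ↭.trans (↭.prep y zs↭) (↭.swap y x ↭.refl)) (insertions-↭ x ys))

  permutations-↭ : ∀ {A : Set} (xs : List A) → All (_↭ xs) (permutations xs)
  permutations-↭ []       = ↭.refl ∷ []
  permutations-↭ (x ∷ xs) = All.concat⁺ (All.map⁺ (All.map
    (λ ys↭ → All.map (λ zs↭ → ↭.trans zs↭ (↭.prep x ys↭)) (insertions-↭ x _)) (permutations-↭ xs)))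

  table-∈ : ∀ {n} {Q} {f : Subset n → Carrier} {X} → X ∈ˡ Q → table Q f X ≡ f X
  table-∈ {Q = Q} {X = X} X∈Q rewrite dec-true (any? (X ≟ˢ_) Q) X∈Q = refl

-- Counting indices that lie close together.

module _ {A : Set} {P : Pred A 0ℓ} (P? : Decidable P) where

  length-filter-bounded : ∀ (h : ℕ → A) m k → (∀ j → P (h j) → j ℕ.< k) →
                          length (filter P? (applyUpTo h m)) ℕ.≤ k
  length-filter-bounded h zero    k       bound = z≤n
  length-filter-bounded h (suc m) k       bound with P? (h 0)
  length-filter-bounded h (suc m) k       bound | no  _  =
    length-filter-bounded (h ∘ suc) m k λ j p → ℕ.≤-trans (ℕ.n≤1+n _) (bound (suc j) p)
  length-filter-bounded h (suc m) zero    bound | yes p₀ = contradiction (bound 0 p₀) λ ()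
  length-filter-bounded h (suc m) (suc k) bound | yes _  =
    s≤s (length-filter-bounded (h ∘ suc) m k λ j p → ℕ.≤-pred (bound (suc j) p))

  -- The first index satisfying `P` confines all later ones to the next `k`, and
  -- `length-filter-bounded` counts those. Shifting `h` keeps the hypothesis intact until that first
  -- index is met.
  length-filter-window : ∀ (h : ℕ → A) m k → (∀ i j → P (h i) → P (h (i ℕ.+ j)) → j ℕ.≤ k) →
                         length (filter P? (applyUpTo h m)) ℕ.≤ suc k
  length-filter-window h zero    k window = z≤n
  length-filter-window h (suc m) k window with P? (h 0)
  ... | no  _  = length-filter-window (h ∘ suc) m k (window ∘ suc)
  ... | yes p₀ = s≤s (length-filter-bounded (h ∘ suc) m k λ j → window 0 (suc j) p₀)

-- Arithmetic in the ordered field.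

module Arithmetic (F : ArchimedeanOrderedField) where

  open ParallelKnapsack F
  open Finite F
  open Properties
  open CommutativeRing commutativeRing
    using (sym; trans; +-assoc; +-congˡ; +-congʳ; +-identityˡ; +-identityʳ; -‿inverseʳ;
           *-assoc; *-comm; *-congˡ; *-congʳ; *-identityˡ; *-identityʳ; distribʳ; zeroˡ; zeroʳ;
           semiring; commutativeSemiring)
    renaming (refl to ≈-refl)
  open import Algebra.Properties.Semiring.Mult semiring using (×1-homo-*)
  open import Algebra.Properties.Semiring.Exp semiring using (^-homo-*)
  open import Algebra.Solver.Ring.NaturalCoefficients.Default commutativeSemiring
    using (solve; _:=_; _:*_)
  open IsDecTotalOrder isDecTotalOrder public
    using (≤-respˡ-≈; ≤-respʳ-≈)
    renaming (reflexive to ≤-reflexive; refl to ≤-refl; trans to ≤-trans)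
  module ≤-Reasoning = PartialOrderReasoning (TotalOrder.poset totalOrder)

  +-mono-≤ : ∀ {w x y z} → w ≤ x → y ≤ z → w + y ≤ x + z
  +-mono-≤ {x = x} {y} w≤x y≤z = ≤-trans (+-monoˡ-≤ y w≤x) (+-monoʳ-≤ x y≤z)

  *-mono-≤ : ∀ {w x y z} → 0# ≤ w → 0# ≤ z → w ≤ x → y ≤ z → w * y ≤ x * z
  *-mono-≤ 0≤w 0≤z w≤x y≤z = ≤-trans (*-monoʳ-≤ 0≤w y≤z) (*-monoˡ-≤ 0≤z w≤x)

  fromℕ-mono : ∀ {m n} → m ℕ.≤ n → fromℕ m ≤ fromℕ n
  fromℕ-mono {n = zero}  z≤n     = ≤-refl
  fromℕ-mono {n = suc n} z≤n     = ≤-respˡ-≈ (+-identityˡ 0#) (+-mono-≤ 0≤1 (fromℕ-mono {n = n} z≤n))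
  fromℕ-mono             (s≤s p) = +-monoʳ-≤ 1# (fromℕ-mono p)

  x+y≤y⇒x≤0 : ∀ {x y} → x + y ≤ y → x ≤ 0#
  x+y≤y⇒x≤0 {x} {y} p = ≤-respˡ-≈
    (trans (+-assoc x y (- y)) (trans (+-congˡ (-‿inverseʳ y)) (+-identityʳ x)))
    (≤-respʳ-≈ (-‿inverseʳ y) (+-monoˡ-≤ (- y) p))

  0<1 : 0# < 1#
  0<1 = 0≤1 , 0≉1

  fromℕ-cancel : ∀ {m n} → fromℕ m ≤ fromℕ n → m ℕ.≤ n
  fromℕ-cancel {m} {n} p = ℕ.≮⇒≥ λ n<m →
    <⇒≱ 0<1 (x+y≤y⇒x≤0 (≤-trans (fromℕ-mono n<m) p))

  fromℕ-* : ∀ m n → fromℕ (m ℕ.* n) ≈ fromℕ m * fromℕ n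
  fromℕ-* = ×1-homo-*

  0≤fromℕ : ∀ n → 0# ≤ fromℕ n
  0≤fromℕ n = fromℕ-mono {0} {n} z≤n

  ≤ceiling : ∀ {m x} → fromℕ m ≤ x → m ℕ.≤ ⌈ x ⌉
  ≤ceiling p = fromℕ-cancel (≤-trans p (⌈⌉-spec _))

  <-≤-trans : ∀ {x y z} → x < y → y ≤ z → x < z
  <-≤-trans x<y y≤z = ≰⇒> λ z≤x → <⇒≱ x<y (≤-trans y≤z z≤x)

  0<fromℕ : ∀ n .{{_ : NonZero n}} → 0# < fromℕ n
  0<fromℕ (suc n) = <-≤-trans 0<1 (≤-respˡ-≈ (+-identityʳ 1#) (+-monoʳ-≤ 1# (0≤fromℕ n)))

  x*[x⁻¹*y]≈y : ∀ {x} y → 0# < x → x * (x ⁻¹ * y) ≈ y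
  x*[x⁻¹*y]≈y {x} y 0<x =
    trans (sym (*-assoc _ _ _)) (trans (*-congʳ (*-inverseʳ (positive⇒≉0 0<x))) (*-identityˡ y))

  x⁻¹*[x*y]≈y : ∀ {x} y → 0# < x → x ⁻¹ * (x * y) ≈ y
  x⁻¹*[x*y]≈y y 0<x = trans (solve 3 (λ a b c → a :* (b :* c) := b :* (a :* c)) ≈-refl _ _ _)
    (x*[x⁻¹*y]≈y y 0<x)

  *-cancelˡ-≈ : ∀ {x y z} → 0# < x → x * y ≈ x * z → y ≈ z
  *-cancelˡ-≈ {x} {y} {z} 0<x p =
    trans (sym (x⁻¹*[x*y]≈y y 0<x)) (trans (*-congˡ p) (x⁻¹*[x*y]≈y z 0<x))

  *-positive : ∀ {x y} → 0# < x → 0# < y → 0# < x * y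
  *-positive {x} {y} 0<x 0<y = *-nonNegative (proj₁ 0<x) (proj₁ 0<y) ,
    λ 0≈xy → proj₂ 0<y (*-cancelˡ-≈ 0<x (trans (zeroʳ x) 0≈xy))

  ⁻¹-positive : ∀ {x} → 0# < x → 0# < x ⁻¹
  ⁻¹-positive {x} 0<x = ⁻¹-nonNegative 0<x ,
    λ 0≈x⁻¹ → 0≉1 (trans (sym (zeroʳ x)) (trans (*-congˡ 0≈x⁻¹) (*-inverseʳ (positive⇒≉0 0<x))))

  ⁻¹-homo-* : ∀ {x y} → 0# < x → 0# < y → (x * y) ⁻¹ ≈ x ⁻¹ * y ⁻¹
  ⁻¹-homo-* {x} {y} 0<x 0<y = *-cancelˡ-≈ (*-positive 0<x 0<y) (begin-equality
    x * y * (x * y) ⁻¹     ≈⟨ *-inverseʳ (positive⇒≉0 (*-positive 0<x 0<y)) ⟩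
    1#                     ≈⟨ *-inverseʳ (positive⇒≉0 0<y) ⟨
    y * y ⁻¹               ≈⟨ x*[x⁻¹*y]≈y (y * y ⁻¹) 0<x ⟨
    x * (x ⁻¹ * (y * y ⁻¹)) ≈⟨ solve 4 (λ a b c d → a :* (b :* (c :* d)) := (a :* c) :* (b :* d))
                                ≈-refl x (x ⁻¹) y (y ⁻¹) ⟩
    x * y * (x ⁻¹ * y ⁻¹)  ∎)
    where open ≤-Reasoning

  ^-positive : ∀ {x} → 0# < x → ∀ k → 0# < x ^ k
  ^-positive 0<x zero    = 0<1
  ^-positive 0<x (suc k) = *-positive 0<x (^-positive 0<x k)

  *-cancelˡ-≤ : ∀ {x y z} → 0# < x → x * y ≤ x * z → y ≤ z
  *-cancelˡ-≤ {x} {y} {z} 0<x xy≤xz = ≤-respˡ-≈ (x⁻¹*[x*y]≈y y 0<x) (≤-respʳ-≈ (x⁻¹*[x*y]≈y z 0<x)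
    (*-monoʳ-≤ (⁻¹-nonNegative 0<x) xy≤xz))

  -- A change of base: `n ≤ 2 ^ lg n`, and every factor 2 is paid for by `a` factors `b`.
  fromℕ-≤^ : ∀ {b} a → 1# + 1# ≤ b ^ a → 0# < b → ∀ n → fromℕ n ≤ b ^ (a ℕ.* lg n)
  fromℕ-≤^ {b} a 2≤bᵃ 0<b n = ≤-trans (fromℕ-mono (ℕ.<⇒≤ (n<2^lg n))) (powers (lg n))
    where
    open ≤-Reasoning
    powers : ∀ j → fromℕ (2 ℕ.^ j) ≤ b ^ (a ℕ.* j)
    powers zero    rewrite ℕ.*-zeroʳ a = ≤-reflexive (+-identityʳ 1#)
    powers (suc j) rewrite ℕ.*-suc a j = begin
      fromℕ (2 ℕ.* 2 ℕ.^ j)        ≈⟨ fromℕ-* 2 (2 ℕ.^ j) ⟩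
      fromℕ 2 * fromℕ (2 ℕ.^ j)    ≈⟨ *-congʳ (+-congˡ (+-identityʳ 1#)) ⟩
      (1# + 1#) * fromℕ (2 ℕ.^ j)  ≤⟨ *-mono-≤ (≤-respˡ-≈ (+-identityˡ 0#) (+-mono-≤ 0≤1 0≤1))
                                         (proj₁ (^-positive 0<b (a ℕ.* j))) 2≤bᵃ (powers j) ⟩
      b ^ a * b ^ (a ℕ.* j)        ≈⟨ ^-homo-* b a (a ℕ.* j) ⟨
      b ^ (a ℕ.+ a ℕ.* j)          ∎

  -- The number of points of a geometric grid.

  module Grid {b : Carrier} (0<b : 0# < b) (b<1 : b < 1#) where

    0<b⁻¹ : 0# < b ⁻¹
    0<b⁻¹ = ⁻¹-positive 0<b

    1<b⁻¹ : 1# < b ⁻¹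
    1<b⁻¹ = ≰⇒> λ b⁻¹≤1 → <⇒≱ b<1 (≤-respˡ-≈ (*-inverseʳ (positive⇒≉0 0<b))
      (≤-respʳ-≈ (*-identityʳ b) (*-monoʳ-≤ (proj₁ 0<b) b⁻¹≤1)))

    b^ℤ[-+] : ∀ k → b ^ℤ (ℤ.- (+ k)) ≡ (b ⁻¹) ^ k
    b^ℤ[-+] zero    = refl
    b^ℤ[-+] (suc k) = refl

    b⁻ʲbʲ≈1 : ∀ j → (b ⁻¹) ^ j * b ^ j ≈ 1#
    b⁻ʲbʲ≈1 zero    = *-identityˡ 1#
    b⁻ʲbʲ≈1 (suc j) = trans
      (solve 4 (λ x y z w → (x :* y) :* (z :* w) := z :* (x :* (y :* w))) ≈-refl _ _ _ _)
      (trans (x*[x⁻¹*y]≈y _ 0<b) (b⁻ʲbʲ≈1 j))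

    b⁻ʲbⁱ⁺ʲ≈bⁱ : ∀ i j → (b ⁻¹) ^ j * b ^ (i ℕ.+ j) ≈ b ^ i
    b⁻ʲbⁱ⁺ʲ≈bⁱ i j = begin-equality
      (b ⁻¹) ^ j * b ^ (i ℕ.+ j)    ≈⟨ *-congˡ (^-homo-* b i j) ⟩
      (b ⁻¹) ^ j * (b ^ i * b ^ j)  ≈⟨ solve 3 (λ x y z → x :* (y :* z) := y :* (x :* z)) ≈-refl _ _ _ ⟩
      b ^ i * ((b ⁻¹) ^ j * b ^ j)  ≈⟨ *-congˡ (b⁻ʲbʲ≈1 j) ⟩
      b ^ i * 1#                    ≈⟨ *-identityʳ _ ⟩
      b ^ i                         ∎
      where open ≤-Reasoning

    ^ℤ-positive : ∀ z → 0# < b ^ℤ z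
    ^ℤ-positive (+ k)    = ^-positive 0<b k
    ^ℤ-positive -[1+ k ] = ^-positive 0<b⁻¹ (suc k)

    grid-positive : ∀ lo hi → All (0# <_) (grid b lo hi)
    grid-positive lo hi = All.filter⁺ (λ x → (lo ≤? x) ×-dec (x ≤? hi))
      (All.map⁺ (All.universal (λ z → ^ℤ-positive (ℤ.- z)) (exponents b lo hi)))

    module _ {lo hi R : Carrier} {k : ℕ}
             (hi≤R*lo : hi ≤ R * lo) (0≤R : 0# ≤ R) (R≤ : R ≤ (b ⁻¹) ^ k) where

      -- The quotient of two points of the interval is at most `R`, hence at most `(b ⁻¹) ^ k`.
      -- Everything is stated with products because `lo` may be zero; only the positive `x` is
      -- cancelled.
      exponents-close : ∀ {x y j} → 0# < x → (b ⁻¹) ^ j * x ≤ y → lo ≤ x → y ≤ hi → j ℕ.≤ k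
      exponents-close {x} {y} {j} 0<x βʲx≤y lo≤x y≤hi = ^-cancelʳ-≤ 1<b⁻¹ j k (*-cancelˡ-≤ 0<x (begin
        x * (b ⁻¹) ^ j  ≈⟨ *-comm _ _ ⟩
        (b ⁻¹) ^ j * x  ≤⟨ βʲx≤y ⟩
        y               ≤⟨ y≤hi ⟩
        hi              ≤⟨ hi≤R*lo ⟩
        R * lo          ≤⟨ *-mono-≤ 0≤R (proj₁ 0<x) R≤ lo≤x ⟩
        (b ⁻¹) ^ k * x  ≈⟨ *-comm _ _ ⟩
        x * (b ⁻¹) ^ k  ∎))
        where open ≤-Reasoning

      -- The exponents are enumerated as nonnegative ones followed by negative ones, and each half
      -- lies in a window of its own. This gives `k + 1` twice; the factor 2 is absorbed by the
      -- constants.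
      grid-length : length (grid b lo hi) ℕ.≤ suc k ℕ.+ suc k
      grid-length = begin
        length (grid b lo hi)
          ≡⟨ cong (length ∘ filter in?) (split p q) ⟩
        length (filter in? (applyUpTo nonneg p ++ applyUpTo neg q))
          ≡⟨ cong length (filter-++ in? (applyUpTo nonneg p) _) ⟩
        length (filter in? (applyUpTo nonneg p) ++ filter in? (applyUpTo neg q))
          ≡⟨ length-++ (filter in? (applyUpTo nonneg p)) ⟩
        length (filter in? (applyUpTo nonneg p)) ℕ.+ length (filter in? (applyUpTo neg q))
          ≤⟨ ℕ.+-mono-≤ (length-filter-window in? nonneg p k nonneg-window)
                        (length-filter-window in? neg q k neg-window) ⟩
        suc k ℕ.+ suc k ∎
        where
        open ℕ.≤-Reasoning
        open ≡ using (cong)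
        p q : ℕ
        p = suc (⌈log b ⁻¹ ⌉ hi)
        q = ⌈log b ⁻¹ ⌉ (lo ⁻¹)
        in? : Decidable (λ x → lo ≤ x × x ≤ hi)
        in? x = (lo ≤? x) ×-dec (x ≤? hi)
        power : ℤ → Carrier
        power z = b ^ℤ (ℤ.- z)
        nonneg neg : ℕ → Carrier
        nonneg = power ∘ +_
        neg    = power ∘ -[1+_]
        split : ∀ p q → map power (map +_ (upTo p) ++ map -[1+_] (upTo q)) ≡
                        applyUpTo nonneg p ++ applyUpTo neg q
        split p q = ≡.trans (map-++ power (map +_ (upTo p)) (map -[1+_] (upTo q)))
          (≡.cong₂ _++_ (≡.trans (≡.sym (map-∘ {g = power} {f = +_} (upTo p))) (map-upTo nonneg p))
                        (≡.trans (≡.sym (map-∘ {g = power} {f = -[1+_]} (upTo q))) (map-upTo neg q)))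
        nonneg-window : ∀ i j → lo ≤ nonneg i × nonneg i ≤ hi →
                        lo ≤ nonneg (i ℕ.+ j) × nonneg (i ℕ.+ j) ≤ hi → j ℕ.≤ k
        nonneg-window i j (lo≤ , _) (_ , ≤hi) rewrite b^ℤ[-+] i | b^ℤ[-+] (i ℕ.+ j) =
          exponents-close (^-positive 0<b⁻¹ i)
            (≤-reflexive (trans (*-comm _ _) (sym (^-homo-* (b ⁻¹) i j)))) lo≤ ≤hi
        neg-window : ∀ i j → lo ≤ neg i × neg i ≤ hi →
                     lo ≤ neg (i ℕ.+ j) × neg (i ℕ.+ j) ≤ hi → j ℕ.≤ k
        -- Along `neg` the values decrease, so the later point is the smaller one and the two
        -- endpoint conditions change places.
        neg-window i j (_ , ≤hi) (lo≤ , _) =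
          exponents-close (^-positive 0<b (suc i ℕ.+ j)) (≤-reflexive (b⁻ʲbⁱ⁺ʲ≈bⁱ (suc i) j)) lo≤ ≤hi

  -- Sums and costs of sets.

  module _ {A : Set} {g : A → Carrier} where

    Σ-filter-mono : ∀ {P Q : Pred A 0ℓ} (P? : Decidable P) (Q? : Decidable Q) → (∀ x → 0# ≤ g x) →
                    (∀ {x} → P x → Q x) → ∀ xs → Σ[ filter P? xs ] g ≤ Σ[ filter Q? xs ] g
    Σ-filter-mono P? Q? 0≤g P⊆Q []       = ≤-refl
    Σ-filter-mono P? Q? 0≤g P⊆Q (x ∷ xs) with P? x | Q? x
    ... | yes _ | yes _  = +-monoʳ-≤ (g x) (Σ-filter-mono P? Q? 0≤g P⊆Q xs)
    ... | yes p | no ¬q  = contradiction (P⊆Q p) ¬q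
    ... | no  _ | yes _  = ≤-respˡ-≈ (+-identityˡ _) (+-mono-≤ (0≤g x) (Σ-filter-mono P? Q? 0≤g P⊆Q xs))
    ... | no  _ | no  _  = Σ-filter-mono P? Q? 0≤g P⊆Q xs

    Σ-nonNegative : (∀ x → 0# ≤ g x) → ∀ xs → 0# ≤ Σ[ xs ] g
    Σ-nonNegative 0≤g []       = ≤-refl
    Σ-nonNegative 0≤g (x ∷ xs) = ≤-respˡ-≈ (+-identityˡ 0#) (+-mono-≤ (0≤g x) (Σ-nonNegative 0≤g xs))

    ∈⇒≤Σ : (∀ x → 0# ≤ g x) → ∀ {x xs} → x ∈ˡ xs → g x ≤ Σ[ xs ] g
    ∈⇒≤Σ 0≤g {x} (here {xs = xs} refl) =
      ≤-respˡ-≈ (+-identityʳ _) (+-monoʳ-≤ (g x) (Σ-nonNegative 0≤g xs))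
    ∈⇒≤Σ 0≤g (there {x = y} x∈) = ≤-respˡ-≈ (+-identityˡ _) (+-mono-≤ (0≤g y) (∈⇒≤Σ 0≤g x∈))

    Σ≤length* : ∀ {B} → (∀ x → g x ≤ B) → ∀ xs → Σ[ xs ] g ≤ fromℕ (length xs) * B
    Σ≤length* {B} g≤B []       = ≤-reflexive (sym (zeroˡ B))
    Σ≤length* {B} g≤B (x ∷ xs) = ≤-respʳ-≈
      (sym (trans (distribʳ B 1# (fromℕ (length xs))) (+-congʳ (*-identityˡ B))))
      (+-mono-≤ (g≤B x) (Σ≤length* g≤B xs))

  module Cost {n} {c : Fin n → Carrier} (0<c : ∀ u → 0# < c u) where

    0≤c : ∀ u → 0# ≤ c u
    0≤c u = proj₁ (0<c u)

    cost-mono : ∀ {X Y : Subset n} → X ⊆ Y → cost c X ≤ cost c Y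
    cost-mono {X} {Y} X⊆Y = Σ-filter-mono (_∈? X) (_∈? Y) 0≤c X⊆Y (allFin n)

    cost-nonNegative : ∀ X → 0# ≤ cost c X
    cost-nonNegative X = Σ-nonNegative 0≤c (elements X)

    ∈⇒≤cost : ∀ {X u} → u ∈ X → c u ≤ cost c X
    ∈⇒≤cost u∈X = ∈⇒≤Σ 0≤c (∈-elements⁺ u∈X)

    cost≤n*B : ∀ {B} → 0# ≤ B → (∀ u → c u ≤ B) → ∀ X → cost c X ≤ fromℕ n * B
    cost≤n*B 0≤B c≤B X = ≤-trans (Σ≤length* c≤B (elements X))
      (*-monoˡ-≤ 0≤B (fromℕ-mono (length-elements X)))

    cost-empty : ∀ {X} → (∀ u → u ∉ X) → cost c X ≈ 0#
    cost-empty {X} ∉X rewrite filter-none (_∈? X) {xs = allFin n} (All.universal ∉X _) = ≈-refl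

-- Midpoints in the binary search.

⌊/2⌋-double≤ : ∀ m → ⌊ m /2⌋ ℕ.+ ⌊ m /2⌋ ℕ.≤ m
⌊/2⌋-double≤ m = ≡.subst (⌊ m /2⌋ ℕ.+ ⌊ m /2⌋ ℕ.≤_) (ℕ.⌊n/2⌋+⌈n/2⌉≡n m)
  (ℕ.+-monoʳ-≤ ⌊ m /2⌋ (ℕ.⌊n/2⌋≤⌈n/2⌉ m))

≤1+⌊/2⌋-double : ∀ m → m ℕ.≤ suc (⌊ m /2⌋ ℕ.+ ⌊ m /2⌋)
≤1+⌊/2⌋-double m = ≡.subst₂ ℕ._≤_ (ℕ.⌊n/2⌋+⌈n/2⌉≡n m) (ℕ.+-suc ⌊ m /2⌋ ⌊ m /2⌋)
  (ℕ.+-monoʳ-≤ ⌊ m /2⌋ (ℕ.⌊n/2⌋-mono (ℕ.n≤1+n (suc m))))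

≤-midpoint : ∀ lo hi → lo ℕ.≤ hi → lo ℕ.≤ ⌊ lo ℕ.+ hi /2⌋
≤-midpoint lo hi lo≤hi = ≡.subst (ℕ._≤ ⌊ lo ℕ.+ hi /2⌋) (≡.sym (ℕ.n≡⌊n+n/2⌋ lo))
  (ℕ.⌊n/2⌋-mono (ℕ.+-monoʳ-≤ lo lo≤hi))

midpoint-< : ∀ lo hi → lo ℕ.< hi → ⌊ lo ℕ.+ hi /2⌋ ℕ.< hi
midpoint-< lo hi lo<hi = ℕ.≰⇒> λ hi≤mid → ℕ.n≮n (hi ℕ.+ hi) (ℕ.≤-<-trans
  (ℕ.≤-trans (ℕ.+-mono-≤ hi≤mid hi≤mid) (⌊/2⌋-double≤ (lo ℕ.+ hi))) (ℕ.+-monoˡ-< hi lo<hi))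

-- Floors disappear after doubling: twice the midpoint is at most `lo + hi`, which is below
-- `2 lo + 2 ^ (k + 1)`.
lower-half : ∀ lo hi k → hi ℕ.< lo ℕ.+ 2 ℕ.^ suc k → ⌊ lo ℕ.+ hi /2⌋ ℕ.< lo ℕ.+ 2 ℕ.^ k
lower-half lo hi k small = ℕ.≰⇒> λ q → ℕ.n≮n (lo ℕ.+ hi) (begin-strict
  lo ℕ.+ hi                                  <⟨ ℕ.+-monoʳ-< lo small ⟩
  lo ℕ.+ (lo ℕ.+ 2 ℕ.* 2 ℕ.^ k)              ≡⟨ rearrange lo (2 ℕ.^ k) ⟩
  (lo ℕ.+ 2 ℕ.^ k) ℕ.+ (lo ℕ.+ 2 ℕ.^ k)      ≤⟨ ℕ.+-mono-≤ q q ⟩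
  ⌊ lo ℕ.+ hi /2⌋ ℕ.+ ⌊ lo ℕ.+ hi /2⌋        ≤⟨ ⌊/2⌋-double≤ (lo ℕ.+ hi) ⟩
  lo ℕ.+ hi                                  ∎)
  where
  open ℕ.≤-Reasoning
  rearrange : ∀ a p → a ℕ.+ (a ℕ.+ 2 ℕ.* p) ≡ (a ℕ.+ p) ℕ.+ (a ℕ.+ p)
  rearrange = solve-∀

-- Doubling again: `2 mid + 1 ≥ lo + hi`, so twice the right-hand side exceeds
-- `lo + hi + 2 ^ (k + 1)`, which exceeds `2 hi`.
upper-half : ∀ lo hi k → hi ℕ.< lo ℕ.+ 2 ℕ.^ suc k → hi ℕ.< suc ⌊ lo ℕ.+ hi /2⌋ ℕ.+ 2 ℕ.^ k
upper-half lo hi k small = ℕ.≰⇒> λ q → ℕ.n≮n (hi ℕ.+ hi) (begin-strict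
  hi ℕ.+ hi                                  <⟨ ℕ.+-monoˡ-< hi small ⟩
  (lo ℕ.+ 2 ℕ.* 2 ℕ.^ k) ℕ.+ hi              ≡⟨ rearrange₁ lo hi (2 ℕ.^ k) ⟩
  (lo ℕ.+ hi) ℕ.+ 2 ℕ.* 2 ℕ.^ k              ≤⟨ ℕ.+-monoˡ-≤ _ (≤1+⌊/2⌋-double (lo ℕ.+ hi)) ⟩
  suc (mid ℕ.+ mid) ℕ.+ 2 ℕ.* 2 ℕ.^ k        ≤⟨ ℕ.n≤1+n _ ⟩
  suc (suc (mid ℕ.+ mid) ℕ.+ 2 ℕ.* 2 ℕ.^ k)  ≡⟨ rearrange₂ mid (2 ℕ.^ k) ⟩
  (suc mid ℕ.+ 2 ℕ.^ k) ℕ.+ (suc mid ℕ.+ 2 ℕ.^ k)  ≤⟨ ℕ.+-mono-≤ q q ⟩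
  hi ℕ.+ hi                                  ∎)
  where
  open ℕ.≤-Reasoning
  mid = ⌊ lo ℕ.+ hi /2⌋
  rearrange₁ : ∀ a b p → (a ℕ.+ 2 ℕ.* p) ℕ.+ b ≡ (a ℕ.+ b) ℕ.+ 2 ℕ.* p
  rearrange₁ = solve-∀
  rearrange₂ : ∀ m p → suc (suc (m ℕ.+ m) ℕ.+ 2 ℕ.* p) ≡ (suc m ℕ.+ p) ℕ.+ (suc m ℕ.+ p)
  rearrange₂ = solve-∀

-- Inclusions of sets, and bisection.

module Subroutines (F : ArchimedeanOrderedField) where

  open ParallelKnapsack F
  open Executions F
  open Finite F
  open CommutativeRing commutativeRing using (-‿inverseʳ)

  ∪-least : ∀ {n} {X Y Z : Subset n} → X ⊆ Z → Y ⊆ Z → X ∪ Y ⊆ Z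
  ∪-least {X = X} {Y} X⊆Z Y⊆Z = [ X⊆Z , Y⊆Z ]′ ∘ x∈p∪q⁻ X Y

  ⁅⁆-⊆ : ∀ {n} {u : Fin n} {X} → u ∈ X → ⁅ u ⁆ ⊆ X
  ⁅⁆-⊆ {u = u} {X} u∈X v∈ = ≡.subst (_∈ X) (≡.sym (x∈⁅y⁆⇒x≡y u v∈)) u∈X

  fromList-⊆ : ∀ {n} {vs : List (Fin n)} {X} → (∀ {u} → u ∈ˡ vs → u ∈ X) → fromList vs ⊆ X
  fromList-⊆ {vs = vs} vs⊆X = vs⊆X ∘ ∈-fromList⁻ vs

  nonempty⇒0<∣∣ : ∀ {n} {X : Subset n} → Nonempty X → 0 ℕ.< ∣ X ∣
  nonempty⇒0<∣∣ (u , u∈X) = ℕ.≤-<-trans z≤n (p⊂q⇒∣p∣<∣q∣ (⊆-min _ , u , u∈X , ∉⊥))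

  length-concatMap : ∀ {a c} {A : Set a} {C : Set c} {h : A → List C} {m} → (∀ x → length (h x) ℕ.≤ m) →
                     ∀ xs → length (concatMap h xs) ℕ.≤ length xs ℕ.* m
  length-concatMap         h≤m []       = z≤n
  length-concatMap {h = h} h≤m (x ∷ xs) = ≡.subst (ℕ._≤ _) (≡.sym (length-++ (h x)))
    (ℕ.+-mono-≤ (h≤m x) (length-concatMap h≤m xs))

  take-⊆ : ∀ {A : Set} {x : A} s {xs} → x ∈ˡ take s xs → x ∈ˡ xs
  take-⊆ s {xs} x∈ = ≡.subst (_ ∈ˡ_) (take++drop≡id s xs) (∈-++⁺ˡ x∈)

  module _ {n} {f : Subset n → Carrier} where

    marginal-∈ : ∀ {u X} → u ∈ X → marginal f u X ≈ 0#
    marginal-∈ {u} {X} u∈X = ≡.subst (λ Y → f Y - f X ≈ 0#)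
      (⊆-antisym (p⊆p∪q ⁅ u ⁆) (∪-least id (⁅⁆-⊆ u∈X))) (-‿inverseʳ (f X))

    module _ (usm : Subset n → Prog n (Subset n)) (search : Search)
             (ε B : Carrier) (c : Fin n → Carrier) where
      open Algorithm usm search ε B c

      -- Φ need not be monotone: the index found has passed its probe or is d itself.
      bisect-within : ∀ {probe : ℕ → Prog n Bool} {Φ : ℕ → Set} {Q d} →
                      (∀ i → i ℕ.≤ d → Within f 1 Q (λ b → b ≡ true → Φ i) (probe i)) →
                      Φ d → ∀ j → d ℕ.< 2 ℕ.^ j → Within f (j ℕ.* 1) (j ℕ.* Q) Φ (bisect probe d)
      bisect-within {probe} {Φ} {Q} {d} probes Φd j d<2ʲ = weaken
        (ℕ.≤-reflexive (ℕ.+-identityʳ _)) (ℕ.≤-reflexive (ℕ.+-identityʳ _)) id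
        (bind-within (while-within Bracket exhausted narrow j (0 , d) (z≤n , ℕ.≤-refl , d<2ʲ , Φd))
          λ (lo , hi) (lo≮hi , _ , lo≤hi , _ , _ , Φhi) → ret-within
            (≡.subst Φ (≡.sym (ℕ.≤-antisym lo≤hi (ℕ.≮⇒≥ (does-false⁻ (lo ℕ.<? hi) lo≮hi)))) Φhi))
        where
        -- `Φ hi` starts as `Φ d` and is renewed by each successful probe. The gap `hi - lo` stays
        -- below `2 ^ k`, so at `k = 0` the bracket has closed.
        Bracket : ℕ → ℕ × ℕ → Set
        Bracket k (lo , hi) = lo ℕ.≤ hi × hi ℕ.≤ d × hi ℕ.< lo ℕ.+ 2 ℕ.^ k × Φ hi
        exhausted : ∀ s → Bracket 0 s → ¬ (proj₁ s ℕ.<ᵇ proj₂ s) ≡ true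
        exhausted (lo , hi) (_ , _ , hi<lo+1 , _) lo<hi = ℕ.<⇒≱ hi<lo+1
          (≡.subst (ℕ._≤ hi) (ℕ.+-comm 1 lo) (does⁻ (lo ℕ.<? hi) lo<hi))
        narrow = λ k (lo , hi) (lo≤hi , hi≤d , small , Φhi) lo<ᵇhi →
          let lo<hi   = does⁻ (lo ℕ.<? hi) lo<ᵇhi
              mid<hi  = midpoint-< lo hi lo<hi
          in weaken ℕ.≤-refl (ℕ.≤-reflexive (ℕ.+-identityʳ Q)) id
               (bind-within (probes _ (ℕ.≤-trans (ℕ.<⇒≤ mid<hi) hi≤d)) λ where
                 true  Φmid → ret-within (≤-midpoint lo hi lo≤hi , ℕ.≤-trans (ℕ.<⇒≤ mid<hi) hi≤d ,
                                          lower-half lo hi k small , Φmid refl)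
                 false _    → ret-within (mid<hi , hi≤d , upper-half lo hi k small , Φhi))

-- GetSEQ: length and saturation of the sampled sequence.

module Sampling (F : ArchimedeanOrderedField) where

  open ParallelKnapsack F
  open Executions F
  open Finite F
  open Arithmetic F
  open Subroutines F

  module _ {n} (usm : Subset n → Prog n (Subset n)) (search : Search)
           (ε B : Carrier) {c : Fin n → Carrier} (0<c : ∀ u → 0# < c u) where

    open Algorithm usm search ε B c
    open Cost 0<c

    Feasible : Subset n → Set
    Feasible X = cost c X ≤ B

    feasible-⊆ : ∀ {X Y} → X ⊆ Y → Feasible Y → Feasible X
    feasible-⊆ X⊆Y = ≤-trans (cost-mono X⊆Y)

    Saturates : Subset n → Subset n → List (Fin n) → Set
    Saturates A L V = ∀ {u} → u ∈ L → u ∈ˡ V ⊎ ¬ Feasible (A ∪ fromList V ∪ ⁅ u ⁆)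

    -- No query is made, so any finite bound on the iterations costs nothing; `n` serves, because
    -- each iteration removes an element from `L`. The length is at most `r` because `V` has no
    -- repetitions and `A ∪ fromList V` stays feasible.
    getSEQ-within : ∀ {f r A L₀} → (∀ X → Feasible X → ∣ X ∣ ℕ.≤ r) → Feasible A →
                    (∀ {u} → u ∈ L₀ → Feasible (A ∪ ⁅ u ⁆)) →
                    Within f 0 0 (λ V → length V ℕ.≤ r × Saturates A L₀ V) (getSEQ A L₀)
    getSEQ-within {r = r} {A} {L₀} ∣∣≤r A-feasible L₀-feasible = weaken
      (ℕ.≤-reflexive (≡.trans (ℕ.+-identityʳ _) (ℕ.*-zeroʳ n)))
      (ℕ.≤-reflexive (≡.trans (ℕ.+-identityʳ _) (ℕ.*-zeroʳ n))) id
      (bind-within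
        (while-within (λ k (V , L) → Partial k V L) exhausted extend n ([] , L₀) initial) finish)
      where
      -- `candidate` makes at least one element of each permutation fit, so `L` shrinks; `fresh`
      -- keeps `V` free of repetitions. In `saturated` an element leaves `L` only by entering `V` or
      -- by ceasing to fit, and both are permanent as `V` grows.
      record Partial (k : ℕ) (V : List (Fin n)) (L : Subset n) : Set where
        field
          size      : ∣ L ∣ ℕ.≤ k
          unique    : Unique V
          feasible  : Feasible (A ∪ fromList V)
          fresh     : ∀ {u} → u ∈ L → u ∉ fromList V
          candidate : ∀ {u} → u ∈ L → Feasible (A ∪ fromList V ∪ ⁅ u ⁆)
          saturated : ∀ {u} → u ∈ L₀ → u ∈ L ⊎ (u ∈ˡ V ⊎ ¬ Feasible (A ∪ fromList V ∪ ⁅ u ⁆))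

      initial : Partial n [] L₀
      initial = record
        { size      = ∣p∣≤n L₀
        ; unique    = []
        ; feasible  = feasible-⊆ (∪-least id (⊆-min A)) A-feasible
        ; fresh     = λ _ → ∉⊥
        ; candidate = λ {u} u∈ → feasible-⊆
            (∪-least (p⊆p∪q ⁅ u ⁆) (∪-least (⊆-min _) (q⊆p∪q A ⁅ u ⁆))) (L₀-feasible u∈)
        ; saturated = inj₁
        }

      exhausted : ∀ ((V , L) : List (Fin n) × Subset n) → Partial 0 V L → ¬ does (nonempty? L) ≡ true
      exhausted (V , L) p eq = ℕ.<⇒≱ (nonempty⇒0<∣∣ (does⁻ (nonempty? L) eq)) (Partial.size p)

      finish = λ (V , L) (L-empty , _ , p) → let open Partial p in ret-within
        ( ℕ.≤-trans (length≤∣fromList∣ unique)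
            (ℕ.≤-trans (p⊆q⇒∣p∣≤∣q∣ (q⊆p∪q A (fromList V))) (∣∣≤r _ feasible))
        , λ u∈ → [ (λ u∈L → contradiction (_ , u∈L) (does-false⁻ (nonempty? L) L-empty)) , id ]′
                   (saturated u∈))

      extend = λ k (V , L) p L-nonempty → bind-within
        (draw-within (All.map⁺ (permutations-↭ (elements L))))
        (λ vs vs↭L → ret-within (extended p (does⁻ (nonempty? L) L-nonempty) vs vs↭L))
        where
        extended : ∀ {k V L} → Partial (suc k) V L → Nonempty L → ∀ vs → vs ↭ elements L →
          let s  = greatest (λ i → feasible? (A ∪ fromList V ∪ fromList (take i vs))) (length vs)
              V′ = V ++ take s vs
          in  Partial k V′ ⟪ (λ u → u ∈? (L ─ fromList V′) ×-dec feasible? (A ∪ fromList V′ ∪ ⁅ u ⁆)) ⟫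
        extended {k} {V} {L} p (v₀ , v₀∈L) vs vs↭L = record
          { size      = ℕ.≤-pred (ℕ.≤-trans (p⊂q⇒∣p∣<∣q∣ L′⊂L) (Partial.size p))
          ; unique    = Unique.++⁺ (Partial.unique p) (Unique.take⁺ s vs-unique)
                          λ (v∈V , v∈vs) → Partial.fresh p (vs⊆L (take-⊆ s v∈vs)) (∈-fromList⁺ v∈V)
          ; feasible  = feasible-⊆ (∪-least (p⊆p∪q _) (fromList-⊆ V′⊆)) s-feasible
          ; fresh     = λ u∈ → proj₂ (∈-─⁻ {X = L} (proj₁ (∈-⟪⟫⁻ L′? u∈)))
          ; candidate = λ u∈ → proj₂ (∈-⟪⟫⁻ L′? u∈)
          ; saturated = λ u∈ →
              [ keep , inj₂ ∘ [ inj₁ ∘ ∈-++⁺ˡ , inj₂ ∘ still ]′ ]′ (Partial.saturated p u∈)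
          }
          where
          s : ℕ
          s = greatest (λ i → feasible? (A ∪ fromList V ∪ fromList (take i vs))) (length vs)
          V′ : List (Fin n)
          V′ = V ++ take s vs
          L′? : Decidable (λ u → u ∈ (L ─ fromList V′) × Feasible (A ∪ fromList V′ ∪ ⁅ u ⁆))
          L′? u = u ∈? (L ─ fromList V′) ×-dec feasible? (A ∪ fromList V′ ∪ ⁅ u ⁆)

          vs⊆L : ∀ {v} → v ∈ˡ vs → v ∈ L
          vs⊆L v∈ = ∈-elements⁻ (∈-resp-↭ vs↭L v∈)

          vs-unique : Unique vs
          vs-unique = Permutationₛ.Unique-resp-↭ (≡.setoid (Fin n))
            (↭.↭⇒↭ₛ (↭.↭-sym vs↭L)) (elements-unique L)

          s-feasible : Feasible (A ∪ fromList V ∪ fromList (take s vs))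
          s-feasible = greatest-satisfies
            (λ i → feasible? (A ∪ fromList V ∪ fromList (take i vs))) (length vs)
            -- `greatest` falls back to index 0, where the prefix is empty and adds nothing to
            -- `A ∪ fromList V`.
            (feasible-⊆ (∪-least (p⊆p∪q _) (∪-least (q⊆p∪q A _) (⊆-min _))) (Partial.feasible p))

          V′⊆ : ∀ {u} → u ∈ˡ V′ → u ∈ A ∪ fromList V ∪ fromList (take s vs)
          V′⊆ u∈ = x∈p∪q⁺ (inj₂ (x∈p∪q⁺
            ([ inj₁ ∘ ∈-fromList⁺ , inj₂ ∘ ∈-fromList⁺ ]′ (∈-++⁻ V u∈))))

          first : ∃ λ v → v ∈ L × v ∈ˡ take s vs
          -- `v₀` only shows that `vs` is nonempty. The witness is the head of `vs`, which is always
          -- appended because `1 ≤ s`.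
          first = start vs refl (∈-resp-↭ (↭.↭-sym vs↭L) (∈-elements⁺ v₀∈L))
            where
            start : ∀ ws → ws ≡ vs → v₀ ∈ˡ ws → ∃ λ v → v ∈ L × v ∈ˡ take s vs
            start (w ∷ ws) refl _ = w , vs⊆L (here refl) , w∈ s 1≤s
              where
              1≤s : 1 ℕ.≤ s
              1≤s = greatest-maximal
                (λ i → feasible? (A ∪ fromList V ∪ fromList (take i vs))) (length vs)
                (feasible-⊆ (∪-least (p⊆p∪q _) (∪-least (q⊆p∪q A _ ∘ p⊆p∪q _)
                    (∪-least (q⊆p∪q A _ ∘ q⊆p∪q _ _) (⊆-min _))))
                  (Partial.candidate p (vs⊆L (here refl))))
                (s≤s z≤n)
              w∈ : ∀ k → 1 ℕ.≤ k → w ∈ˡ take k vs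
              w∈ (suc k) _ = here refl

          L′⊂L : ⟪ L′? ⟫ ⊂ L
          L′⊂L = let v , v∈L , v∈vs = first in
            (λ u∈ → proj₁ (∈-─⁻ (proj₁ (∈-⟪⟫⁻ L′? u∈)))) , v , v∈L ,
            λ v∈ → proj₂ (∈-─⁻ {X = L} (proj₁ (∈-⟪⟫⁻ L′? v∈))) (∈-fromList⁺ (∈-++⁺ʳ V v∈vs))

          keep : ∀ {u} → u ∈ L → u ∈ ⟪ L′? ⟫ ⊎ (u ∈ˡ V′ ⊎ ¬ Feasible (A ∪ fromList V′ ∪ ⁅ u ⁆))
          keep {u} u∈L with u ∈? fromList V′ | feasible? (A ∪ fromList V′ ∪ ⁅ u ⁆)
          ... | yes u∈ | _     = inj₂ (inj₁ (∈-fromList⁻ V′ u∈))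
          ... | no  _  | no ¬q = inj₂ (inj₂ ¬q)
          ... | no  u∉ | yes q = inj₁ (∈-⟪⟫⁺ L′? (x∈p∧x∉q⇒x∈p─q u∈L u∉ , q))

          still : ∀ {u} → ¬ Feasible (A ∪ fromList V ∪ ⁅ u ⁆) → ¬ Feasible (A ∪ fromList V′ ∪ ⁅ u ⁆)
          still ¬q = ¬q ∘ feasible-⊆ (∪-least (p⊆p∪q _) (∪-least
            (λ v∈ → x∈p∪q⁺ (inj₂ (x∈p∪q⁺ (inj₁ (∈-fromList⁺ (∈-++⁺ˡ (∈-fromList⁻ V v∈)))))))
            (q⊆p∪q A _ ∘ q⊆p∪q _ _)))

-- Filtering by density, and the search for the index `t₁`.

module Filtering (F : ArchimedeanOrderedField) where

  open ParallelKnapsack F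
  open Executions F
  open Finite F
  open Arithmetic F
  open Properties
  open Subroutines F
  open Sampling F
  open CommutativeRing commutativeRing using (sym; trans; *-congʳ; zeroˡ)

  module _ {n} {f : Subset n → Carrier} (usm : Subset n → Prog n (Subset n))
           (ε B : Carrier) (ε<1 : ε < 1#) {c : Fin n → Carrier} (0<c : ∀ u → 0# < c u) where

    open Cost 0<c

    -- The contract met by both implementations, each with its own `θR` and `θQ`. The analysis of
    -- the iterations sees the search only through it.
    ThresholdsWithin : Search → ℕ → ℕ → ℕ → Set₁
    ThresholdsWithin search r θR θQ = ∀ {ρ A L V} →
      let open Algorithm.Thresholds usm search ε B c ρ A L V in
      0# < ρ → length V ℕ.≤ r → Saturates usm search ε B 0<c A L V →
      Within f θR θQ (λ (t₁ , _) → cost c (E⁺ f t₁) ≤ (1# - ε) * cost c L) (thresholds search)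

    dense-within : ∀ {search ρ A L} → let open Algorithm usm search ε B c in
      Within f 1 (suc n)
        (λ L′ → ∀ {u} → u ∈ L′ → u ∈ L × ρ ≤ marginal f u A / c u × cost c (A ∪ ⁅ u ⁆) ≤ B)
        (dense ρ A L)
    dense-within {search} {ρ} {A} {L} = weaken ℕ.≤-refl
      (≡.subst (ℕ._≤ suc n) (≡.sym (≡.trans (ℕ.+-identityʳ _) (≡.cong suc (length-map _ (elements L)))))
        (s≤s (length-elements L))) id
      (bind-within ask-within λ { g refl → ret-within result })
      where
      open Algorithm usm search ε B c
      Q : List (Subset n)
      Q = A ∷ map (λ u → A ∪ ⁅ u ⁆) (elements L)
      table-marginal : ∀ {u} → u ∈ L → marginal (table Q f) u A ≡ marginal f u A
      table-marginal u∈L = ≡.cong₂ _-_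
        (table-∈ {Q = Q} {f} (there (∈-map⁺ _ (∈-elements⁺ u∈L)))) (table-∈ {Q = Q} {f} (here refl))
      dense? : Decidable λ u → u ∈ L × ρ ≤ marginal (table Q f) u A / c u × cost c (A ∪ ⁅ u ⁆) ≤ B
      dense? u = u ∈? L ×-dec (ρ ≤? marginal (table Q f) u A / c u) ×-dec feasible? (A ∪ ⁅ u ⁆)
      result : ∀ {u} → u ∈ ⟪ dense? ⟫ →
               u ∈ L × ρ ≤ marginal f u A / c u × cost c (A ∪ ⁅ u ⁆) ≤ B
      result {u} u∈ =
        let u∈L , ρ≤ , q = ∈-⟪⟫⁻ dense? u∈
        in  u∈L , ≡.subst (λ m → ρ ≤ m / c u) (table-marginal u∈L) ρ≤ , q

    module _ {search : Search} {ρ : Carrier} {A L : Subset n} {V : List (Fin n)} where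

      open Algorithm usm search ε B c hiding (probe)
      open Thresholds ρ A L V

      Shrinks : (Subset n → Carrier) → ℕ → Set
      Shrinks g i = cost c (E⁺ g i) ≤ (1# - ε) * cost c L

      -- A table is faithful only on the sets asked, hence the restriction to `L`; membership in
      -- `E⁺` looks at no other marginals.
      Agree : (Subset n → Carrier) → (Subset n → Carrier) → ℕ → Set
      Agree g h i = ∀ {u} → u ∈ L → marginal g u (G i) ≡ marginal h u (G i)

      E⁺-member? : ∀ g i → Decidable λ u →
        u ∈ L × ρ ≤ marginal g u (G i) / c u × cost c (G i ∪ ⁅ u ⁆) ≤ B
      E⁺-member? g i u = u ∈? L ×-dec (ρ ≤? marginal g u (G i) / c u) ×-dec feasible? (G i ∪ ⁅ u ⁆)

      Shrinks-agree : ∀ g h i → Agree g h i → Shrinks g i → Shrinks h i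
      Shrinks-agree g h i g≗h = ≤-trans (cost-mono λ {u} u∈ →
        let u∈L , ρ≤ , q = ∈-⟪⟫⁻ (E⁺-member? h i) u∈
        in  ∈-⟪⟫⁺ (E⁺-member? g i) (u∈L , ≡.subst (λ m → ρ ≤ m / c u) (≡.sym (g≗h u∈L)) ρ≤ , q))

      -- A member of `V` lies in `G d`, so its marginal is zero and misses the positive threshold;
      -- every other element of `L` no longer fits.
      shrinks-at-end : 0# < ρ → Saturates usm search ε B 0<c A L V → Shrinks f d
      shrinks-at-end 0<ρ saturates = ≤-respˡ-≈ (sym (cost-empty empty))
        (*-nonNegative (≤⇒0≤- (proj₁ ε<1)) (cost-nonNegative L))
        where
        V⊆G : fromList V ⊆ G d
        V⊆G u∈ = x∈p∪q⁺ (inj₂ (≡.subst (λ W → _ ∈ fromList W) (≡.sym (take-all d V ℕ.≤-refl)) u∈))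
        empty : ∀ u → u ∉ E⁺ f d
        empty u u∈ with ∈-⟪⟫⁻ (E⁺-member? f d) u∈
        ... | u∈L , ρ≤ , q with saturates u∈L
        ... | inj₁ u∈V = <⇒≱ 0<ρ (≤-respʳ-≈
          (trans (*-congʳ (marginal-∈ {f = f} (V⊆G (∈-fromList⁺ u∈V)))) (zeroˡ _)) ρ≤)
        ... | inj₂ ¬q = ¬q (≤-trans (cost-mono (∪-least (p⊆p∪q _ ∘ p⊆p∪q _)
          (∪-least (p⊆p∪q _ ∘ V⊆G) (q⊆p∪q _ _)))) q)

      table-agree : ∀ m is {i} → i ℕ.≤ m → i ∈ˡ is → Agree (table (sets m is) f) f i
      table-agree m is {i} i≤m i∈is u∈L = ≡.cong₂ _-_
        (table-∈ {Q = sets m is} {f} (∈-++⁺ʳ (map G (upTo (suc m)))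
          (∈-concatMap⁺ _ (Any.map (λ { refl → ∈-map⁺ _ (∈-elements⁺ u∈L) }) i∈is))))
        (table-∈ {Q = sets m is} {f} (∈-++⁺ˡ (∈-map⁺ G (∈-upTo⁺ (s≤s i≤m)))))

      length-sets : ∀ m is → length (sets m is) ℕ.≤ suc m ℕ.+ length is ℕ.* n
      length-sets m is = ≡.subst (ℕ._≤ suc m ℕ.+ length is ℕ.* n)
        (≡.sym (length-++ (map G (upTo (suc m)))))
        (ℕ.+-mono-≤ (ℕ.≤-reflexive (≡.trans (length-map G (upTo (suc m))) (length-upTo (suc m))))
          (length-concatMap
            (λ i → ≡.subst (ℕ._≤ n) (≡.sym (length-map _ (elements L))) (length-elements L)) is))

      exhaustive-within : 0# < ρ → Saturates usm search ε B 0<c A L V →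
        Within f 1 (suc d ℕ.+ suc d ℕ.* n) (λ (t₁ , _) → Shrinks f t₁) (thresholds exhaustive)
      exhaustive-within 0<ρ saturates = weaken ℕ.≤-refl
        (≡.subst₂ (λ x y → x ℕ.≤ suc d ℕ.+ y ℕ.* n) (≡.sym (ℕ.+-identityʳ _)) (length-upTo (suc d))
          (length-sets d (upTo (suc d)))) id
        (bind-within ask-within λ { g refl →
          ret-within (result (table (sets d (upTo (suc d))) f) agree) })
        where
        agree : ∀ {i} → i ℕ.≤ d → Agree (table (sets d (upTo (suc d))) f) f i
        agree i≤d = table-agree d (upTo (suc d)) i≤d (∈-upTo⁺ (s≤s i≤d))
        result : ∀ g → (∀ {i} → i ℕ.≤ d → Agree g f i) → Shrinks f (least (shrinks? g) d)
        -- Two transfers: from `f` to the table at `d`, so that the search must succeed, and from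
        -- the table back to `f` at the index found.
        result g agree = Shrinks-agree g f (least (shrinks? g) d) (agree (least-≤ (shrinks? g) d))
          (least-satisfies (shrinks? g) d (Shrinks-agree f g d (λ u∈L → ≡.sym (agree ℕ.≤-refl u∈L))
            (shrinks-at-end 0<ρ saturates)))

      -- Each probe has a table of its own, so what is kept of it is a statement `Φ` that does not
      -- mention tables. Only success is recorded, as bisection relies only on indices where a probe
      -- succeeded. The `suc d` counts the prefixes up to `i`, the `n` the extensions at `i`.
      probe-within : ∀ {P : (Subset n → Carrier) → Pred ℕ 0ℓ} (P? : ∀ g → Decidable (P g)) {Φ : Set} i →
        i ℕ.≤ d → (P (table (sets i [ i ]) f) i → Φ) →
        Within f 1 (suc d ℕ.+ n) (λ b → b ≡ true → Φ) (probe P? i)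
      probe-within P? {Φ} i i≤d P⇒Φ = weaken ℕ.≤-refl
        (≡.subst (ℕ._≤ suc d ℕ.+ n) (≡.sym (ℕ.+-identityʳ _))
          (ℕ.≤-trans (length-sets i [ i ]) (ℕ.+-mono-≤ (s≤s i≤d) (ℕ.≤-reflexive (ℕ.+-identityʳ n))))) id
        (bind-within ask-within λ { g refl → ret-within {Φ = λ b → b ≡ true → Φ}
          (P⇒Φ ∘ does⁻ (P? (table (sets i [ i ]) f) i)) })

      binary-within : 0# < ρ → Saturates usm search ε B 0<c A L V → ∀ j → d ℕ.< 2 ℕ.^ j →
        Within f (j ℕ.+ j) (j ℕ.* (suc d ℕ.+ n) ℕ.+ j ℕ.* (suc d ℕ.+ n))
          (λ (t₁ , _) → Shrinks f t₁) (thresholds binary)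
      binary-within 0<ρ saturates j d<2ʲ = weaken
        (ℕ.≤-reflexive (≡.cong₂ ℕ._+_ (ℕ.*-identityʳ j) (≡.trans (ℕ.+-identityʳ _) (ℕ.*-identityʳ j))))
        (ℕ.≤-reflexive (≡.cong (j ℕ.* (suc d ℕ.+ n) ℕ.+_) (ℕ.+-identityʳ _))) id
        (bind-within
          (bisect-within usm search ε B c {probe = probe shrinks?} {Φ = Shrinks f}
            (λ i i≤d → probe-within shrinks? i i≤d
              (Shrinks-agree (table (sets i [ i ]) f) f i (table-agree i [ i ] ℕ.≤-refl (here refl))))
            (shrinks-at-end 0<ρ saturates) j d<2ʲ)
          λ t₁ shrinks → bind-within
            -- The trivial postcondition still bounds the number of probes: the bracket is halved
            -- whatever the answers are.
            (bisect-within usm search ε B c {probe = probe loses?} {Φ = λ _ → ⊤}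
              (λ i i≤d → probe-within loses? i i≤d _) tt j d<2ʲ)
            λ t₂ _ → ret-within shrinks)

-- Counting in units of one search.

module Scaling (F : ArchimedeanOrderedField) where

  open ParallelKnapsack F
  open Executions F

  -- The unit of cost is θR rounds and θQ queries, one search for t₁ and t₂.
  record Costs {n} (f : Subset n → Carrier) (θR θQ : ℕ) {A : Set} (a : ℕ) (Φ : A → Set) (P : Prog n A)
         : Set₁ where
    constructor costs
    field
      execution-within : Within f (a ℕ.* θR) (a ℕ.* θQ) Φ P

  module _ {n} {f : Subset n → Carrier} {θR θQ : ℕ} where

    costs-ret : ∀ {A} {Φ : A → Set} {x} → Φ x → Costs f θR θQ 0 Φ (ret x)
    costs-ret φ = costs (ret-within φ)

    costs-bind : ∀ {A B a b Φ Ψ} {P : Prog n A} {k : A → Prog n B} → Costs f θR θQ a Φ P →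
                 (∀ x → Φ x → Costs f θR θQ b Ψ (k x)) → Costs f θR θQ (a ℕ.+ b) Ψ (P >>= k)
    costs-bind {a = a} {b} (costs w) w′ = costs (weaken
      (ℕ.≤-reflexive (≡.sym (ℕ.*-distribʳ-+ θR a b))) (ℕ.≤-reflexive (≡.sym (ℕ.*-distribʳ-+ θQ a b)))
      id (bind-within w λ x φ → Costs.execution-within (w′ x φ)))

    costs-while : ∀ {S a test} {body : S → Prog n S} (Inv : ℕ → S → Set) →
                  (∀ s → Inv 0 s → ¬ test s ≡ true) →
                  (∀ k s → Inv (suc k) s → test s ≡ true → Costs f θR θQ a (Inv k) (body s)) →
                  ∀ k s → Inv k s →
                  Costs f θR θQ (k ℕ.* a) (λ s → test s ≡ false × ∃ λ j → Inv j s) (while test body s)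
    costs-while {a = a} Inv stops step k s inv = costs (weaken
      (ℕ.≤-reflexive (≡.sym (ℕ.*-assoc k a θR))) (ℕ.≤-reflexive (≡.sym (ℕ.*-assoc k a θQ)))
      id (while-within Inv stops (λ k s inv eq → Costs.execution-within (step k s inv eq)) k s inv))

    costs-weaken : ∀ {A a b} {Φ Ψ : A → Set} {P : Prog n A} → a ℕ.≤ b → (∀ {x} → Φ x → Ψ x) →
                   Costs f θR θQ a Φ P → Costs f θR θQ b Ψ P
    costs-weaken a≤b Φ⊆Ψ (costs w) = costs (weaken (ℕ.*-monoˡ-≤ θR a≤b) (ℕ.*-monoˡ-≤ θQ a≤b) Φ⊆Ψ w)

    costs-if : ∀ {A a Φ} {P Q : Prog n A} b → Costs f θR θQ a Φ P → Costs f θR θQ a Φ Q →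
               Costs f θR θQ a Φ (if b then P else Q)
    costs-if true  p q = p
    costs-if false p q = q

-- The iterations of RandBatch.

module Iterations (F : ArchimedeanOrderedField) where

  open ParallelKnapsack F
  open Executions F
  open Finite F
  open Arithmetic F
  open Properties
  open Sampling F
  open Filtering F
  open Scaling F
  open CommutativeRing commutativeRing
    using (sym; trans; *-congʳ; *-congˡ; *-comm; *-assoc; *-identityʳ; -‿inverseʳ; +-congʳ; +-identityˡ)

  -- Tails has weight `1# - 1#` and is filtered out. Thus `A` is extended and `count` updated in
  -- every iteration, which is what guarantees progress.
  bernoulli-1 : All (λ (_ , heads) → heads ≡ true) (bernoulli 1#)
  bernoulli-1 = All.tabulate λ o∈ → case ∈-filter⁻ (λ o → 0# <? proj₁ o)
    {xs = (1# , true) ∷ (1# - 1# , false) ∷ []} o∈ of λ where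
      (here refl , _)                 → refl
      (there (here refl) , (_ , 0≉0)) → contradiction (sym (-‿inverseʳ 1#)) 0≉0

  0<1-x : ∀ {x} → x < 1# → 0# < 1# - x
  0<1-x {x} x<1 = ≤⇒0≤- (proj₁ x<1) , λ 0≈1-x → <⇒≱ x<1 (≤-reflexive
    (trans (sym (x-y+y≈x 1# x)) (trans (+-congʳ (sym 0≈1-x)) (+-identityˡ x))))

  x*[y*[x⁻¹*z]]≈y*z : ∀ {x} y z → 0# < x → x * (y * (x ⁻¹ * z)) ≈ y * z
  x*[y*[x⁻¹*z]]≈y*z {x} y z 0<x = trans (sym (*-assoc _ _ _)) (trans (*-congʳ (*-comm x y))
    (trans (*-assoc _ _ _) (*-congˡ (x*[x⁻¹*y]≈y z 0<x))))

  module _ {n} {f : Subset n → Carrier} (usm : Subset n → Prog n (Subset n)) (search : Search)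
           (ε B : Carrier) (ε<1 : ε < 1#) (0≤B : 0# ≤ B)
           {c : Fin n → Carrier} (0<c : ∀ u → 0# < c u) (c≤B : ∀ u → c u ≤ B)
           (r : ℕ) (∣∣≤r : ∀ X → cost c X ≤ B → ∣ X ∣ ℕ.≤ r)
           {θR θQ : ℕ} (1≤θR : 1 ℕ.≤ θR) (1≤θQ : 1 ℕ.≤ θQ) (n≤θQ : n ℕ.≤ θQ) where

    open Algorithm usm search ε B c
    open Cost 0<c
    module _ (thresholds-within : ThresholdsWithin {f = f} usm ε B ε<1 0<c search r θR θQ)
             {w : Carrier} {k₀ : ℕ} (n*B≤w*βᵏ : fromℕ n * B ≤ w * ((1# - ε) ⁻¹) ^ k₀) where

      Heavy : Subset n → Set
      Heavy X = ∀ {u} → u ∈ X → w < c u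

      -- Two units, because `1` and `n` are each bounded by one `θQ`.
      dense-costs : ∀ {ρ A L} → Costs f θR θQ 2
        (λ L′ → ∀ {u} → u ∈ L′ → u ∈ L × ρ ≤ marginal f u A / c u × cost c (A ∪ ⁅ u ⁆) ≤ B)
        (dense ρ A L)
      dense-costs = costs (weaken (ℕ.≤-trans 1≤θR (ℕ.m≤m+n θR _))
        (ℕ.+-mono-≤ 1≤θQ (ℕ.≤-trans n≤θQ (ℕ.m≤m+n θQ 0))) id
          (dense-within usm ε B ε<1 0<c {search = search}))

      module _ {ρ : Carrier} {I : Subset n} {M : ℕ} (0<ρ : 0# < ρ) (heavy : Heavy I) where

        -- Each iteration either increments count, which uses up batches, or
        -- shrinks the cost of L by the factor 1 - ε, which uses up shrinkings.
        record Potential (k : ℕ) (s : State) : Set where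
          open State s
          field
            batches shrinkings : ℕ
            split       : k ≡ batches ℕ.+ shrinkings
            count-bound : M ℕ.≤ count ℕ.+ batches
            cost-bound  : cost c L ≤ w * ((1# - ε) ⁻¹) ^ shrinkings
            L-heavy     : Heavy L
            L-feasible  : ∀ {u} → u ∈ L → cost c (A ∪ ⁅ u ⁆) ≤ B

        Running : State → Set
        Running s = Nonempty (State.L s) × State.count s ℕ.< M

        1≤batches : ∀ {k s} → Running s → (p : Potential k s) → 1 ℕ.≤ Potential.batches p
        1≤batches {s = s} (_ , count<M) p = ℕ.+-cancelˡ-< (State.count s) 0 _
          (ℕ.<-≤-trans (≡.subst (ℕ._< M) (≡.sym (ℕ.+-identityʳ _)) count<M) (Potential.count-bound p))

        -- With no shrinkings left, `cost c L` would be at most `w`, which is less than the cost of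
        -- a single element of `L`.
        1≤shrinkings : ∀ {k s} → Running s → (p : Potential k s) → 1 ℕ.≤ Potential.shrinkings p
        1≤shrinkings ((u , u∈L) , _) p = positive (Potential.shrinkings p) (Potential.cost-bound p)
          where
          positive : ∀ j → cost c _ ≤ w * ((1# - ε) ⁻¹) ^ j → 1 ℕ.≤ j
          positive zero    q = contradiction
            (≤-trans (∈⇒≤cost u∈L) (≤-respʳ-≈ (*-identityʳ w) q)) (<⇒≱ (Potential.L-heavy p u∈L))
          positive (suc j) q = s≤s z≤n

        -- If `t₂ < t₁`, then `count` grows. Otherwise the prefix is cut at `t₁` itself, so `A′` is
        -- `G t₁`, and what survives the next filtering belongs to `E⁺` at `t₁`, whose cost has
        -- shrunk.
        advance : ∀ {k A U count L V t₁ t₂ U′ L′} → let A′ = A ∪ fromList (take (t₁ ℕ.⊓ t₂) V) in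
          Running (state A U count L) → Potential (suc k) (state A U count L) →
          cost c (Thresholds.E⁺ ρ A L V f t₁) ≤ (1# - ε) * cost c L →
          (∀ {u} → u ∈ L′ → u ∈ L × ρ ≤ marginal f u A′ / c u × cost c (A′ ∪ ⁅ u ⁆) ≤ B) →
          Potential k (state A′ U′ (if does (t₂ ℕ.<? t₁) then suc count else count) L′)
        advance {k} {A} {U} {count} {L} {V} {t₁} {t₂} {U′} {L′} running p shrinks L′-spec
          with Potential.batches p | Potential.shrinkings p
             | 1≤batches running p | 1≤shrinkings running p
             | Potential.split p | Potential.count-bound p | Potential.cost-bound p
             | t₂ ℕ.<ᵇ t₁ in t₂<ᵇt₁
        ... | suc m | suc j | _ | _ | split | count-bound | cost-bound | true = record
          { batches     = m
          ; shrinkings  = suc j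
          ; split       = ℕ.suc-injective split
          ; count-bound = ≡.subst (M ℕ.≤_) (ℕ.+-suc count m) count-bound
          ; cost-bound  = ≤-trans (cost-mono (proj₁ ∘ L′-spec)) cost-bound
          ; L-heavy     = Potential.L-heavy p ∘ proj₁ ∘ L′-spec
          ; L-feasible  = proj₂ ∘ proj₂ ∘ L′-spec
          }
        ... | suc m | suc j | _ | _ | split | count-bound | cost-bound | false = record
          { batches     = suc m
          ; shrinkings  = j
          ; split       = ≡.trans (ℕ.suc-injective split) (ℕ.+-suc m j)
          ; count-bound = count-bound
          ; cost-bound  = begin
              cost c L′                              ≤⟨ cost-mono L′⊆E⁺ ⟩
              cost c (Thresholds.E⁺ ρ A L V f t₁)    ≤⟨ shrinks ⟩
              (1# - ε) * cost c L                    ≤⟨ *-monoʳ-≤ (proj₁ (0<1-x ε<1)) cost-bound ⟩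
              (1# - ε) * (w * ((1# - ε) ⁻¹) ^ suc j) ≈⟨ x*[y*[x⁻¹*z]]≈y*z w _ (0<1-x ε<1) ⟩
              w * ((1# - ε) ⁻¹) ^ j                  ∎
          ; L-heavy     = Potential.L-heavy p ∘ proj₁ ∘ L′-spec
          ; L-feasible  = proj₂ ∘ proj₂ ∘ L′-spec
          }
          where
          open ≤-Reasoning
          L′⊆E⁺ : L′ ⊆ Thresholds.E⁺ ρ A L V f t₁
          L′⊆E⁺ {u} u∈ = ∈-⟪⟫⁺ (λ u → u ∈? L ×-dec (ρ ≤? marginal f u (Thresholds.G ρ A L V t₁) / c u)
                                        ×-dec feasible? (Thresholds.G ρ A L V t₁ ∪ ⁅ u ⁆))
            (≡.subst (λ t → let G = A ∪ fromList (take t V) in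
                        u ∈ L × ρ ≤ marginal f u G / c u × cost c (G ∪ ⁅ u ⁆) ≤ B)
              (ℕ.m≤n⇒m⊓n≡m (ℕ.≮⇒≥ (does-false⁻ (t₂ ℕ.<? t₁) t₂<ᵇt₁))) (L′-spec u∈))

        -- Three units per iteration: one for the search, two for `dense`, while sampling and the
        -- coin are free. The first 2 is the initial `dense`.
        randBatch-costs : Costs f θR θQ (2 ℕ.+ ((M ℕ.+ k₀) ℕ.* 3 ℕ.+ 0)) (λ _ → ⊤)
                                (randBatch ρ I M 1#)
        randBatch-costs = costs-bind {a = 2} dense-costs λ L₀ L₀-spec →
          costs-bind {a = (M ℕ.+ k₀) ℕ.* 3}
            (costs-while Potential finished iterate (M ℕ.+ k₀) _ (initial L₀-spec))
            λ _ _ → costs-ret tt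
          where
          initial : ∀ {L₀} →
                    (∀ {u} → u ∈ L₀ → u ∈ I × ρ ≤ marginal f u ⊥ / c u × cost c (⊥ ∪ ⁅ u ⁆) ≤ B) →
                    Potential (M ℕ.+ k₀) (state ⊥ ⊥ 0 L₀)
          initial {L₀} L₀-spec = record
            { batches     = M
            ; shrinkings  = k₀
            ; split       = refl
            ; count-bound = ℕ.≤-refl
            ; cost-bound  = ≤-trans (cost≤n*B 0≤B c≤B L₀) n*B≤w*βᵏ
            ; L-heavy     = heavy ∘ proj₁ ∘ L₀-spec
            ; L-feasible  = proj₂ ∘ proj₂ ∘ L₀-spec
            }
          running : ∀ s → does (nonempty? (State.L s) ×-dec (State.count s ℕ.<? M)) ≡ true → Running s
          running s = does⁻ (nonempty? (State.L s) ×-dec (State.count s ℕ.<? M))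
          finished : ∀ s → Potential 0 s →
                     ¬ does (nonempty? (State.L s) ×-dec (State.count s ℕ.<? M)) ≡ true
          finished s p eq = ℕ.<⇒≱ (ℕ.≤-trans (1≤batches (running s eq) p) (ℕ.m≤m+n _ _))
            (ℕ.≤-reflexive (≡.sym (Potential.split p)))
          iterate = λ k s p eq →
            let open State s
                running-s = running s eq
                _ , u∈L   = proj₁ running-s
            in costs-bind {a = 0}
              (costs (getSEQ-within usm search ε B 0<c ∣∣≤r
                -- The invariant does not list feasibility of `A`: it follows from that of
                -- `A ∪ ⁅ u ⁆` for any `u` in the nonempty `L`.
                (≤-trans (cost-mono (p⊆p∪q _)) (Potential.L-feasible p u∈L)) (Potential.L-feasible p)))
              λ V (V≤r , saturates) → costs-bind {a = 1}
                (costs (weaken (ℕ.m≤m+n θR 0) (ℕ.m≤m+n θQ 0) id (thresholds-within 0<ρ V≤r saturates)))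
                λ (t₁ , t₂) shrinks → costs-bind {a = 0} (costs (draw-within bernoulli-1))
                  λ { heads refl → costs-bind {a = 2} {b = 0} dense-costs λ L′ L′-spec →
                    costs-ret (advance {V = V} {t₁} {t₂} running-s p shrinks λ u∈ →
                      let u∈L─U′ , rest = L′-spec u∈ in proj₁ (∈-─⁻ u∈L─U′) , rest) }

-- Totals for Probe and ParSKP.

module Totals (F : ArchimedeanOrderedField) where

  open ParallelKnapsack F
  open Executions F
  open Finite F
  open Arithmetic F
  open Properties
  open Subroutines F
  open Filtering F
  open Scaling F
  open Iterations F
  open CommutativeRing commutativeRing
    using (sym; trans; +-comm; *-congʳ; *-congˡ; *-identityʳ; semiring; commutativeSemiring)
    renaming (refl to ≈-refl)
  open import Algebra.Properties.Semiring.Exp semiring using (^-homo-*)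
  open import Algebra.Solver.Ring.NaturalCoefficients.Default commutativeSemiring
    using (solve; _:=_; _:*_)

  module _ {ε : Carrier} (0<ε : 0# < ε) (ε<1 : ε < 1#) where

    open Grid (0<1-x ε<1) (≰⇒> λ 1≤1-ε → <⇒≱ 0<ε (x+y≤y⇒x≤0 {y = 1# - ε} (≤-respˡ-≈
      (sym (trans (+-comm _ _) (x-y+y≈x 1# ε))) 1≤1-ε)))

    β : Carrier
    β = (1# - ε) ⁻¹

    -- 2 ≤ β ^ doubling and ε ⁻¹ ≤ β ^ repeats, hence n² / ε ≤ β ^ levels n.
    doubling repeats : ℕ
    doubling = ⌈log β ⌉ (1# + 1#)
    repeats  = ⌈log β ⌉ (ε ⁻¹)

    levels : ℕ → ℕ
    levels n = doubling ℕ.* lg n ℕ.+ (doubling ℕ.* lg n ℕ.+ repeats)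

    ratio : ℕ → Carrier
    ratio n = fromℕ n * (fromℕ n * ε ⁻¹)

    0≤ratio : ∀ n → 0# ≤ ratio n
    0≤ratio n = *-nonNegative (0≤fromℕ n) (*-nonNegative (0≤fromℕ n) (⁻¹-nonNegative 0<ε))

    ratio≤ : ∀ n → ratio n ≤ β ^ levels n
    ratio≤ n = begin
      fromℕ n * (fromℕ n * ε ⁻¹)    ≤⟨ *-mono-≤ (0≤fromℕ n) (0≤^ (k ℕ.+ repeats)) n≤βᵏ (begin
        fromℕ n * ε ⁻¹      ≤⟨ *-mono-≤ (0≤fromℕ n) (0≤^ repeats) n≤βᵏ (⌈log⌉-spec 1<b⁻¹ (ε ⁻¹)) ⟩
        β ^ k * β ^ repeats ≈⟨ ^-homo-* β k repeats ⟨
        β ^ (k ℕ.+ repeats) ∎) ⟩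
      β ^ k * β ^ (k ℕ.+ repeats)   ≈⟨ ^-homo-* β k (k ℕ.+ repeats) ⟨
      β ^ levels n                  ∎
      where
      open ≤-Reasoning
      k : ℕ
      k = doubling ℕ.* lg n
      n≤βᵏ : fromℕ n ≤ β ^ k
      n≤βᵏ = fromℕ-≤^ doubling (⌈log⌉-spec 1<b⁻¹ (1# + 1#)) 0<b⁻¹ n
      0≤^ : ∀ j → 0# ≤ β ^ j
      0≤^ j = proj₁ (^-positive 0<b⁻¹ j)

    module _ {n′ : ℕ} {f : Subset (suc n′) → Carrier}
             (usm : Subset (suc n′) → Prog (suc n′) (Subset (suc n′))) (search : Search)
             {B : Carrier} (0<B : 0# < B)
             {c : Fin (suc n′) → Carrier} (0<c : ∀ u → 0# < c u) (c≤B : ∀ u → c u ≤ B)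
             (r : ℕ) (∣∣≤r : ∀ X → cost c X ≤ B → ∣ X ∣ ℕ.≤ r)
             {θR θQ : ℕ} (1≤θR : 1 ℕ.≤ θR) (1≤θQ : 1 ℕ.≤ θQ) (n≤θQ : suc n′ ℕ.≤ θQ) where

      open Algorithm usm search ε B c

      n : ℕ
      n = suc n′

      w : Carrier
      w = ε * B / fromℕ n

      n*B≤ : fromℕ n * B ≤ w * β ^ levels n
      n*B≤ = begin
        fromℕ n * B                                   ≈⟨ x*[x⁻¹*y]≈y (fromℕ n * B) 0<ε ⟨
        ε * (ε ⁻¹ * (fromℕ n * B))                    ≈⟨ x*[x⁻¹*y]≈y _ (0<fromℕ n) ⟨
        fromℕ n * (fromℕ n ⁻¹ * (ε * (ε ⁻¹ * (fromℕ n * B))))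
          ≈⟨ solve 5 (λ n n⁻¹ ε ε⁻¹ b → n :* (n⁻¹ :* (ε :* (ε⁻¹ :* (n :* b)))) :=
                                        ((ε :* b) :* n⁻¹) :* (n :* (n :* ε⁻¹)))
                     ≈-refl (fromℕ n) (fromℕ n ⁻¹) ε (ε ⁻¹) B ⟩
        w * ratio n                                   ≤⟨ *-monoʳ-≤ 0≤w (ratio≤ n) ⟩
        w * β ^ levels n                              ∎
        where
        open ≤-Reasoning
        0≤w : 0# ≤ w
        0≤w = *-nonNegative (*-nonNegative (proj₁ 0<ε) (proj₁ 0<B)) (⁻¹-nonNegative (0<fromℕ n))

      module _ (thresholds-within : ThresholdsWithin {f = f} usm ε B ε<1 0<c search r θR θQ)
               {κ : ℕ} (usm-costs : ∀ X → Costs f θR θQ κ (λ _ → ⊤) (usm X)) where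

        -- Three units for `1 + 1 + n` sets. Every list asked by `probe` and `parSKP` themselves is
        -- this short, except the final one.
        costs-ask : ∀ {Q} → length Q ℕ.≤ 2 ℕ.+ n → Costs f θR θQ 3 (λ _ → ⊤) (ask Q)
        costs-ask ∣Q∣≤ = costs (weaken (ℕ.≤-trans 1≤θR (ℕ.m≤m+n θR _)) (ℕ.≤-trans ∣Q∣≤
          (ℕ.+-mono-≤ 1≤θQ (ℕ.+-mono-≤ 1≤θQ (ℕ.≤-trans n≤θQ (ℕ.m≤m+n θQ 0))))) _ ask-within)

        batches : ℕ
        batches = ⌈ (ε ^ 2) ⁻¹ ⌉

        -- Two calls of `randBatch` at `2 + 3 (batches + k)` units, three queries at 3 units, and
        -- `κ` units for USM.
        probeCost : ℕ → ℕ
        probeCost k = 6 ℕ.* k ℕ.+ (6 ℕ.* batches ℕ.+ (13 ℕ.+ κ))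

        probe-costs : ∀ {ρ N₁ N₂} → 0# < ρ → (∀ {u} → u ∈ N₁ → w < c u) →
                      Costs f θR θQ (probeCost (levels n)) (λ _ → ⊤) (probe ρ N₁ N₂)
        probe-costs {ρ} {N₁} {N₂} 0<ρ heavy =
          costs-weaken (ℕ.≤-reflexive (total batches (levels n) κ)) id
          (costs-bind {a = b} (batch heavy) λ (A₁ , _) _ →
           costs-bind {a = b} (batch {N₁ ─ A₁} (heavy ∘ proj₁ ∘ ∈-─⁻)) λ _ _ →
           costs-bind {a = 3} (ask-then-ret (s≤s (s≤s (candidates _)))) λ _ _ →
           costs-bind {a = 3} (ask-then-ret (s≤s (s≤s (candidates _)))) λ _ _ →
           costs-if _
             (costs-bind (usm-costs _) λ _ _ →
              ask-then-ret (s≤s (s≤s z≤n)))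
             (costs-weaken z≤n id (costs-ret tt)))
          where
          b : ℕ
          b = 2 ℕ.+ ((batches ℕ.+ levels n) ℕ.* 3 ℕ.+ 0)
          total : ∀ m k κ → let b = 2 ℕ.+ ((m ℕ.+ k) ℕ.* 3 ℕ.+ 0) in
                  b ℕ.+ (b ℕ.+ (3 ℕ.+ (3 ℕ.+ (κ ℕ.+ 3)))) ≡ 6 ℕ.* k ℕ.+ (6 ℕ.* m ℕ.+ (13 ℕ.+ κ))
          total = solve-∀
          ask-then-ret : ∀ {Q} {k : (Subset n → Carrier) → Subset n} → length Q ℕ.≤ 2 ℕ.+ n →
                         Costs f θR θQ 3 (λ _ → ⊤) (ask Q >>= λ g → ret (k g))
          ask-then-ret ∣Q∣≤ = costs-bind {a = 3} {b = 0} (costs-ask ∣Q∣≤) λ _ _ → costs-ret tt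
          batch : ∀ {I} → (∀ {u} → u ∈ I → w < c u) →
                  Costs f θR θQ b (λ _ → ⊤) (randBatch ρ I batches 1#)
          batch = randBatch-costs usm search ε B ε<1 (proj₁ 0<B) 0<c c≤B r ∣∣≤r 1≤θR 1≤θQ n≤θQ
            thresholds-within {k₀ = levels n} n*B≤ {M = batches} 0<ρ
          candidates : ∀ A → length (map (λ u → A ∪ ⁅ u ⁆)
                         (filter (λ u → feasible? (A ∪ ⁅ u ⁆)) (elements N₁))) ℕ.≤ n
          candidates A = ≡.subst (ℕ._≤ n) (≡.sym (length-map _ (filter _ (elements N₁))))
            (ℕ.≤-trans (length-filter (λ u → feasible? (A ∪ ⁅ u ⁆)) (elements N₁)) (length-elements N₁))

        -- The grid bound times the runs per threshold. Besides being an exponent in `levels`,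
        -- `repeats` is the number `repetitions` of `parSKP`.
        runs : ℕ
        runs = (suc (levels n) ℕ.+ suc (levels n)) ℕ.* repeats

        -- Here counting in units ends: `Costs` scales rounds and queries alike, whereas parallel
        -- runs multiply the queries alone.
        probes-within : ∀ {lo hi N₁ N₂} → hi ≤ ratio n * lo → (∀ {u} → u ∈ N₁ → w < c u) →
          Within f (probeCost (levels n) ℕ.* θR) (runs ℕ.* (probeCost (levels n) ℕ.* θQ))
            (λ Ts → length Ts ℕ.≤ runs)
            (par (concatMap (λ ρ → replicate repeats (probe ρ N₁ N₂)) (grid (1# - ε) lo hi)))
        probes-within {lo} {hi} {N₁} {N₂} hi≤ heavy = weaken ℕ.≤-refl
          (ℕ.*-monoˡ-≤ (probeCost (levels n) ℕ.* θQ) ∣Ps∣≤) (λ eq → ≡.subst (ℕ._≤ runs) (≡.sym eq) ∣Ps∣≤)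
          (par-within (All.concat⁺ (All.map⁺ (All.map
            (λ 0<ρ → All.replicate⁺ repeats (Costs.execution-within (probe-costs 0<ρ heavy)))
            (grid-positive lo hi)))))
          where
          ∣Ps∣≤ : length (concatMap (λ ρ → replicate repeats (probe ρ N₁ N₂)) (grid (1# - ε) lo hi))
                  ℕ.≤ runs
          ∣Ps∣≤ = ℕ.≤-trans
            (length-concatMap (λ ρ → ℕ.≤-reflexive (length-replicate repeats)) (grid (1# - ε) lo hi))
            (ℕ.*-monoˡ-≤ repeats (grid-length {k = levels n} hi≤ (0≤ratio n) (ratio≤ n)))

        -- The value `x` read off for `u*` appears in both ends of the interval and never in the
        -- ratio, so one grid bound serves every table, also when both ends are zero.
        ρmax≤ : ∀ α x → fromℕ n ^ 2 * α * x / (ε * B) ≤ ratio n * (α * x / B)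
        ρmax≤ α x = ≤-reflexive (trans (*-congˡ (⁻¹-homo-* 0<ε 0<B)) (trans
          (*-congʳ (*-congʳ (*-congʳ (*-congˡ (*-identityʳ _)))))
          (solve 5 (λ n α x ε⁻¹ B⁻¹ → (((n :* n) :* α) :* x) :* (ε⁻¹ :* B⁻¹) :=
                                      (n :* (n :* ε⁻¹)) :* ((α :* x) :* B⁻¹))
                   ≈-refl (fromℕ n) α x (ε ⁻¹) (B ⁻¹))))

        parSKP-within : ∀ α → let p = probeCost (levels n) in
          Within f (3 ℕ.* θR ℕ.+ (κ ℕ.* θR ℕ.+ (3 ℕ.* θR ℕ.+ (p ℕ.* θR ℕ.+ 1))))
                   (3 ℕ.* θQ ℕ.+ (κ ℕ.* θQ ℕ.+ (3 ℕ.* θQ ℕ.+ (runs ℕ.* (p ℕ.* θQ) ℕ.+ suc runs))))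
                   (λ _ → ⊤) (parSKP α)
        parSKP-within α =
          bind-within (Costs.execution-within (costs-ask (ℕ.≤-trans (ℕ.≤-reflexive
            (≡.trans (length-map ⁅_⁆ (allFin n)) (length-tabulate {n = n} id))) (ℕ.m≤n+m n 2)))) λ g _ →
          -- As `n` is a successor, `allFin n` computes to a nonempty list and `go` to its second
          -- clause.
          bind-within (Costs.execution-within (usm-costs _)) λ Y _ →
          bind-within (Costs.execution-within (costs-ask (s≤s (s≤s z≤n)))) λ h _ →
          bind-within (probes-within (ρmax≤ α _) (∈-⟪⟫⁻ (λ u → w <? c u))) λ Ts ∣Ts∣≤ →
          weaken ℕ.≤-refl (ℕ.≤-trans (ℕ.≤-reflexive (ℕ.+-identityʳ _)) (s≤s ∣Ts∣≤)) id
            (bind-within ask-within λ k _ → ret-within tt)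

-- Collecting the constants.

≤-scale : ∀ a {v} → 1 ℕ.≤ v → a ℕ.≤ a ℕ.* v
≤-scale a {v} 1≤v = ≡.subst (ℕ._≤ a ℕ.* v) (ℕ.*-identityʳ a) (ℕ.*-monoʳ-≤ a 1≤v)

-- The 7 is made of two queries at 3 units and the last round.
rounds-total : ∀ κ P {p ℓ θ} → 1 ℕ.≤ ℓ → 1 ℕ.≤ θ → p ℕ.≤ P ℕ.* ℓ →
  3 ℕ.* θ ℕ.+ (κ ℕ.* θ ℕ.+ (3 ℕ.* θ ℕ.+ (p ℕ.* θ ℕ.+ 1))) ℕ.≤ (7 ℕ.+ κ ℕ.+ P) ℕ.* (ℓ ℕ.* θ)
rounds-total κ P {p} {ℓ} {θ} 1≤ℓ 1≤θ p≤ = ℕ.≤-trans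
  (ℕ.+-mono-≤ (ℕ.*-monoʳ-≤ 3 θ≤) (ℕ.+-mono-≤ (ℕ.*-monoʳ-≤ κ θ≤) (ℕ.+-mono-≤ (ℕ.*-monoʳ-≤ 3 θ≤)
    (ℕ.+-mono-≤ (ℕ.*-monoˡ-≤ θ p≤) (ℕ.≤-trans 1≤θ θ≤)))))
  (ℕ.≤-reflexive (collect κ P ℓ θ))
  where
  θ≤ : θ ℕ.≤ ℓ ℕ.* θ
  θ≤ = ≡.subst (θ ℕ.≤_) (ℕ.*-comm θ ℓ) (≤-scale θ 1≤ℓ)
  collect : ∀ κ P ℓ θ → let v = ℓ ℕ.* θ in
    3 ℕ.* v ℕ.+ (κ ℕ.* v ℕ.+ (3 ℕ.* v ℕ.+ (P ℕ.* ℓ ℕ.* θ ℕ.+ v))) ≡ (7 ℕ.+ κ ℕ.+ P) ℕ.* (ℓ ℕ.* θ)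
  collect = solve-∀

-- The square of `ℓ` comes from the parallel runs alone: about `ℓ` of them, each of about `ℓ` units.
-- The last query, of `suc N` sets, contributes 1 and `S`.
queries-total : ∀ κ P S {p N ℓ θ} → 1 ℕ.≤ ℓ → 1 ℕ.≤ θ → p ℕ.≤ P ℕ.* ℓ → N ℕ.≤ S ℕ.* ℓ →
  3 ℕ.* θ ℕ.+ (κ ℕ.* θ ℕ.+ (3 ℕ.* θ ℕ.+ (N ℕ.* (p ℕ.* θ) ℕ.+ suc N))) ℕ.≤
  (7 ℕ.+ κ ℕ.+ S ℕ.* P ℕ.+ S) ℕ.* (ℓ ℕ.^ 2 ℕ.* θ)
queries-total κ P S {p} {N} {ℓ} {θ} 1≤ℓ 1≤θ p≤ N≤ = ℕ.≤-trans
  (ℕ.+-mono-≤ (ℕ.*-monoʳ-≤ 3 θ≤) (ℕ.+-mono-≤ (ℕ.*-monoʳ-≤ κ θ≤) (ℕ.+-mono-≤ (ℕ.*-monoʳ-≤ 3 θ≤)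
    (ℕ.+-mono-≤ (ℕ.*-mono-≤ N≤ (ℕ.*-monoˡ-≤ θ p≤))
      (ℕ.+-mono-≤ (ℕ.≤-trans 1≤θ θ≤) (ℕ.≤-trans N≤ (ℕ.*-monoʳ-≤ S ℓ≤)))))))
  (ℕ.≤-reflexive (collect κ P S ℓ θ))
  where
  ℓ≤ℓ² : ℓ ℕ.≤ ℓ ℕ.* (ℓ ℕ.* 1)
  ℓ≤ℓ² = ≡.subst (λ x → ℓ ℕ.≤ ℓ ℕ.* x) (≡.sym (ℕ.*-identityʳ ℓ)) (≤-scale ℓ 1≤ℓ)
  ℓ≤ : ℓ ℕ.≤ ℓ ℕ.* (ℓ ℕ.* 1) ℕ.* θ
  ℓ≤ = ℕ.≤-trans ℓ≤ℓ² (≤-scale _ 1≤θ)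
  θ≤ : θ ℕ.≤ ℓ ℕ.* (ℓ ℕ.* 1) ℕ.* θ
  θ≤ = ≡.subst (θ ℕ.≤_) (ℕ.*-comm θ _) (≤-scale θ (ℕ.≤-trans 1≤ℓ ℓ≤ℓ²))
  collect : ∀ κ P S ℓ θ → let v = ℓ ℕ.* (ℓ ℕ.* 1) ℕ.* θ in
    3 ℕ.* v ℕ.+ (κ ℕ.* v ℕ.+ (3 ℕ.* v ℕ.+ (S ℕ.* ℓ ℕ.* (P ℕ.* ℓ ℕ.* θ) ℕ.+ (v ℕ.+ S ℕ.* v)))) ≡
    (7 ℕ.+ κ ℕ.+ S ℕ.* P ℕ.+ S) ℕ.* v
  collect = solve-∀

linear-≤ : ∀ a b {x k ℓ} → 1 ℕ.≤ ℓ → x ℕ.≤ k ℕ.* ℓ → a ℕ.* x ℕ.+ b ℕ.≤ (a ℕ.* k ℕ.+ b) ℕ.* ℓ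
linear-≤ a b {x} {k} {ℓ} 1≤ℓ x≤ = ℕ.≤-trans (ℕ.+-mono-≤ (ℕ.*-monoʳ-≤ a x≤) (≤-scale b 1≤ℓ))
  (ℕ.≤-reflexive (collect a b k ℓ))
  where
  collect : ∀ a b k ℓ → a ℕ.* (k ℕ.* ℓ) ℕ.+ b ℕ.* ℓ ≡ (a ℕ.* k ℕ.+ b) ℕ.* ℓ
  collect = solve-∀

-- Constants independent of the instance, and the theorem.

module Theorem (F : ArchimedeanOrderedField) where

  open ParallelKnapsack F
  open Executions F
  open Finite F
  open Arithmetic F
  open Properties
  open Subroutines F
  open Filtering F
  open Scaling F
  open Totals F
  open CommutativeRing commutativeRing
    using (sym; trans; *-congʳ; *-identityˡ; +-identityʳ; commutativeSemiring)
    renaming (refl to ≈-refl)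
  open import Algebra.Solver.Ring.NaturalCoefficients.Default commutativeSemiring
    using (solve; _:=_; _:*_)

  within⇒complexity : ∀ {n A f R R′ Q Q′ Φ} {P : Prog n A} → R ℕ.≤ R′ → Q ℕ.≤ Q′ →
                      Within f R Q Φ P → Complexity≤ f P R′ Q′
  within⇒complexity R≤R′ Q≤Q′ (within e b) = _ , e ,
    All.map (λ (bounded-by r q _) → ℕ.≤-trans r R≤R′ , ℕ.≤-trans q Q≤Q′) b

  -- One number of units must cover both bounds on USM, so the two ceilings are added. In the second
  -- the factor `n` has been split off; it is covered by `θQ`.
  usmConstant : Carrier → ℕ → ℕ
  usmConstant ε K = ⌈ fromℕ K * (ε ⁻¹ * ℓ) ⌉ ℕ.+ ⌈ fromℕ K * ((ε ^ 4) ⁻¹ * ℓ ^ 3) ⌉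
    where
    ℓ : Carrier
    ℓ = fromℕ (⌈log (1# + 1#) ⌉ (ε ⁻¹))

  usm-within : ∀ {ε K} {usm : ∀ {n} → Subset n → Prog n (Subset n)} → IsUSM ε K usm →
               ∀ {n} {f : Subset n → Carrier} → NonNegative f → Submodular f →
               ∀ {θR θQ} → 1 ℕ.≤ θR → n ℕ.≤ θQ → ∀ X →
               Costs f θR θQ (usmConstant ε K) (λ _ → ⊤) (usm X)
  usm-within {ε} {K} isUSM {n} {f} f≥0 submodular {θR} {θQ} 1≤θR n≤θQ X =
    let _ , e , bounds , _ = isUSM f f≥0 submodular X
    in  costs (within e (All.map (λ (_ , r , q) → bounded-by (rounds≤ r) (queries≤ q) tt) bounds))
    where
    ℓ : Carrier
    ℓ = fromℕ (⌈log (1# + 1#) ⌉ (ε ⁻¹))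
    rounds≤ : ∀ {m} → fromℕ m ≤ fromℕ K * (ε ⁻¹ * ℓ) → m ℕ.≤ usmConstant ε K ℕ.* θR
    rounds≤ p = ℕ.≤-trans (≤ceiling p) (ℕ.≤-trans (ℕ.m≤m+n _ _) (≤-scale (usmConstant ε K) 1≤θR))
    queries≤ : ∀ {m} → fromℕ m ≤ fromℕ K * (fromℕ n / ε ^ 4 * ℓ ^ 3) → m ℕ.≤ usmConstant ε K ℕ.* θQ
    queries≤ {m} p = ℕ.≤-trans (fromℕ-cancel (begin
      fromℕ m                                        ≤⟨ p ⟩
      fromℕ K * (fromℕ n / ε ^ 4 * ℓ ^ 3)
        ≈⟨ solve 4 (λ k n e l → k :* ((n :* e) :* l) := (k :* (e :* l)) :* n)
                 ≈-refl (fromℕ K) (fromℕ n) ((ε ^ 4) ⁻¹) (ℓ ^ 3) ⟩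
      fromℕ K * ((ε ^ 4) ⁻¹ * ℓ ^ 3) * fromℕ n       ≤⟨ *-monoˡ-≤ (0≤fromℕ n) (⌈⌉-spec _) ⟩
      fromℕ q * fromℕ n                              ≈⟨ fromℕ-* q n ⟨
      fromℕ (q ℕ.* n)                                ∎))
      (ℕ.*-mono-≤ (ℕ.m≤n+m q ⌈ fromℕ K * (ε ⁻¹ * ℓ) ⌉) n≤θQ)
      where
      open ≤-Reasoning
      q : ℕ
      q = ⌈ fromℕ K * ((ε ^ 4) ⁻¹ * ℓ ^ 3) ⌉

  length-constant : ∀ {A : Set} {x : A} {xs} → Unique xs → (∀ {y} → y ∈ˡ xs → y ≡ x) → length xs ℕ.≤ 1
  length-constant []                   _  = z≤n
  length-constant (_ ∷ [])             _  = ℕ.≤-refl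
  length-constant ((y≢z ∷ _) ∷ _ ∷ _)  ≡x =
    contradiction (≡.trans (≡x (here refl)) (≡.sym (≡x (there (here refl))))) y≢z

  cost-singleton : ∀ {n} {c : Fin n → Carrier} {B} → 0# ≤ B → (∀ u → c u ≤ B) → ∀ u → cost c ⁅ u ⁆ ≤ B
  cost-singleton {B = B} 0≤B c≤B u = ≤-trans (Σ≤length* c≤B (elements ⁅ u ⁆))
    (≤-respʳ-≈ (trans (*-congʳ (+-identityʳ 1#)) (*-identityˡ B))
      (*-monoˡ-≤ 0≤B (fromℕ-mono (length-constant (elements-unique ⁅ u ⁆) (x∈⁅y⁆⇒x≡y u ∘ ∈-elements⁻)))))

  module _ {ε : Carrier} (0<ε : 0# < ε) (ε<1 : ε < 1#) (κ : ℕ) where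

    -- The rates are `levels`, `probeCost` and `runs` with `lg n` replaced by 1: as `lg n` is at
    -- least 1, it may be factored out of the additive constants too. Only `ε` and `κ` occur, so
    -- they are fixed before `n`.
    levelRate probeRate runRate roundConstant queryConstant : ℕ
    levelRate     = doubling 0<ε ε<1 ℕ.+ (doubling 0<ε ε<1 ℕ.+ repeats 0<ε ε<1)
    probeRate     = 6 ℕ.* levelRate ℕ.+ (6 ℕ.* ⌈ (ε ^ 2) ⁻¹ ⌉ ℕ.+ (13 ℕ.+ κ))
    runRate       = (suc levelRate ℕ.+ suc levelRate) ℕ.* repeats 0<ε ε<1
    roundConstant = 7 ℕ.+ κ ℕ.+ probeRate
    queryConstant = 7 ℕ.+ κ ℕ.+ runRate ℕ.* probeRate ℕ.+ runRate

    module _ (n : ℕ) where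

      levels≤ : levels 0<ε ε<1 n ℕ.≤ levelRate ℕ.* lg n
      levels≤ = ℕ.≤-trans
        (ℕ.+-monoʳ-≤ (d ℕ.* lg n) (ℕ.+-monoʳ-≤ (d ℕ.* lg n) (≤-scale e {lg n} (s≤s z≤n))))
        (ℕ.≤-reflexive (collect d (lg n) e))
        where
        d e : ℕ
        d = doubling 0<ε ε<1
        e = repeats 0<ε ε<1
        collect : ∀ d l e → d ℕ.* l ℕ.+ (d ℕ.* l ℕ.+ e ℕ.* l) ≡ (d ℕ.+ (d ℕ.+ e)) ℕ.* l
        collect = solve-∀

      probeCost≤ : 6 ℕ.* levels 0<ε ε<1 n ℕ.+ (6 ℕ.* ⌈ (ε ^ 2) ⁻¹ ⌉ ℕ.+ (13 ℕ.+ κ))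
                   ℕ.≤ probeRate ℕ.* lg n
      probeCost≤ = linear-≤ 6 (6 ℕ.* ⌈ (ε ^ 2) ⁻¹ ⌉ ℕ.+ (13 ℕ.+ κ))
        {k = levelRate} {lg n} (s≤s z≤n) levels≤

      runs≤ : (suc (levels 0<ε ε<1 n) ℕ.+ suc (levels 0<ε ε<1 n)) ℕ.* repeats 0<ε ε<1
              ℕ.≤ runRate ℕ.* lg n
      runs≤ = ℕ.≤-trans (ℕ.*-monoˡ-≤ e (ℕ.+-mono-≤ suc-levels≤ suc-levels≤))
        (ℕ.≤-reflexive (collect levelRate (lg n) e))
        where
        e : ℕ
        e = repeats 0<ε ε<1
        suc-levels≤ : suc (levels 0<ε ε<1 n) ℕ.≤ suc levelRate ℕ.* lg n
        suc-levels≤ = ℕ.+-mono-≤ (s≤s z≤n) levels≤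
        collect : ∀ k l e → (suc k ℕ.* l ℕ.+ suc k ℕ.* l) ℕ.* e ≡ (suc k ℕ.+ suc k) ℕ.* e ℕ.* l
        collect = solve-∀

theorem3 : (F : ArchimedeanOrderedField) → let open ParallelKnapsack F in
    (ε : Carrier) → 0# < ε → ε < 1# →
    (K : ℕ) (usm : ∀ {n} → Subset n → Prog n (Subset n)) → IsUSM ε K usm →
    ∃ λ (C : ℕ) →
    (n : ℕ) → .{{_ : NonZero n}} →
    (f : Subset n → Carrier) → NonNegative f → Submodular f →
    (c : Fin n → Carrier) → (∀ u → 0# < c u) →
    (B : Carrier) → 0# < B → (∀ u → c u ≤ B) →
    (α : Carrier) → 0# < α → α < 1# →
    (r : ℕ) → IsMaxFeasibleSize c B r →
    Complexity≤ f (Algorithm.parSKP usm exhaustive ε B c α)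
    (C ℕ.* lg n)
    (C ℕ.* (n ℕ.* r ℕ.* lg n ℕ.^ 2))
    × Complexity≤ f (Algorithm.parSKP usm binary ε B c α)
    (C ℕ.* (lg n ℕ.* lg r))
    (C ℕ.* (n ℕ.* lg n ℕ.^ 2 ℕ.* lg r))
theorem3 F ε 0<ε ε<1 K usm isUSM = 2 ℕ.* R ℕ.+ 6 ℕ.* Q , bounds
  where
  open ParallelKnapsack F
  open Executions F
  open Finite F
  open Arithmetic F
  open Filtering F
  open Totals F
  open Theorem F

  κ R Q C : ℕ
  κ = usmConstant ε K
  R = roundConstant 0<ε ε<1 κ
  Q = queryConstant 0<ε ε<1 κ
  -- The four bounds ask for `R`, `4 Q`, `2 R` and `6 Q`; the sum covers them all.
  C = 2 ℕ.* R ℕ.+ 6 ℕ.* Q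

  bounds : ∀ n → .{{_ : NonZero n}} →
    (f : Subset n → Carrier) → NonNegative f → Submodular f →
    (c : Fin n → Carrier) → (∀ u → 0# < c u) →
    (B : Carrier) → 0# < B → (∀ u → c u ≤ B) →
    (α : Carrier) → 0# < α → α < 1# →
    (r : ℕ) → IsMaxFeasibleSize c B r →
    Complexity≤ f (Algorithm.parSKP usm exhaustive ε B c α)
      (C ℕ.* lg n) (C ℕ.* (n ℕ.* r ℕ.* lg n ℕ.^ 2))
    × Complexity≤ f (Algorithm.parSKP usm binary ε B c α)
      (C ℕ.* (lg n ℕ.* lg r)) (C ℕ.* (n ℕ.* lg n ℕ.^ 2 ℕ.* lg r))
  bounds n@(suc n′) f f≥0 submodular c 0<c B 0<B c≤B α _ _ r ((X , _ , ∣X∣≡r) , ∣∣≤r) =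
    within⇒complexity
      (ℕ.≤-trans (rounds-total κ P (s≤s z≤n) (s≤s z≤n) (probeCost≤ 0<ε ε<1 κ n))
        (ℕ.≤-trans (ℕ.≤-reflexive (≡.cong (R ℕ.*_) (ℕ.*-identityʳ (lg n)))) (ℕ.*-monoˡ-≤ (lg n) R≤C)))
      (ℕ.≤-trans (queries-total κ P S (s≤s z≤n) 1≤4nr (probeCost≤ 0<ε ε<1 κ n) (runs≤ 0<ε ε<1 κ n))
        (ℕ.≤-trans (ℕ.≤-reflexive (collect₁ Q (lg n) n r)) (ℕ.*-monoˡ-≤ (n ℕ.* r ℕ.* lg n ℕ.^ 2) 4Q≤C)))
      (parSKP-within 0<ε ε<1 usm exhaustive 0<B 0<c c≤B r ∣∣≤r (s≤s z≤n) 1≤4nr n≤4nr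
        (λ {ρ} {A} {L} {V} 0<ρ V≤r saturates → weaken ℕ.≤-refl (exhaustive≤ V≤r) id
          (exhaustive-within usm ε B ε<1 0<c {exhaustive} {ρ} {A} {L} {V} 0<ρ saturates))
        (usm-within {K = K} isUSM f≥0 submodular (s≤s z≤n) n≤4nr) α)
    , within⇒complexity
      (ℕ.≤-trans (rounds-total κ P (s≤s z≤n) (s≤s z≤n) (probeCost≤ 0<ε ε<1 κ n))
        (ℕ.≤-trans (ℕ.≤-reflexive (collect₂ R (lg n) (lg r)))
          (ℕ.*-monoˡ-≤ (lg n ℕ.* lg r) (ℕ.m≤m+n (2 ℕ.* R) (6 ℕ.* Q)))))
      (ℕ.≤-trans (queries-total κ P S (s≤s z≤n) 1≤6nj (probeCost≤ 0<ε ε<1 κ n) (runs≤ 0<ε ε<1 κ n))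
        (ℕ.≤-trans (ℕ.≤-reflexive (collect₃ Q (lg n) n (lg r)))
          (ℕ.*-monoˡ-≤ (n ℕ.* lg n ℕ.^ 2 ℕ.* lg r) (ℕ.m≤n+m (6 ℕ.* Q) (2 ℕ.* R)))))
      -- `lg r` rounds for each of the two bisections.
      (parSKP-within 0<ε ε<1 usm binary 0<B 0<c c≤B r ∣∣≤r {lg r ℕ.+ lg r} (s≤s z≤n) 1≤6nj n≤6nj
        (λ {ρ} {A} {L} {V} 0<ρ V≤r saturates → weaken ℕ.≤-refl (binary≤ V≤r) id
          (binary-within usm ε B ε<1 0<c {binary} {ρ} {A} {L} {V} 0<ρ saturates (lg r)
            (ℕ.≤-<-trans V≤r (n<2^lg r))))
        (usm-within {K = K} isUSM f≥0 submodular (s≤s z≤n) n≤6nj) α)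
    where
    P S : ℕ
    P = probeRate 0<ε ε<1 κ
    S = runRate 0<ε ε<1 κ

    R≤C : R ℕ.≤ C
    R≤C = ℕ.≤-trans (ℕ.m≤m+n R _) (ℕ.m≤m+n (2 ℕ.* R) (6 ℕ.* Q))
    4Q≤C : 4 ℕ.* Q ℕ.≤ C
    4Q≤C = ℕ.≤-trans (ℕ.*-monoˡ-≤ Q (ℕ.m≤m+n 4 2)) (ℕ.m≤n+m (6 ℕ.* Q) (2 ℕ.* R))

    -- Any single element is feasible because `c u ≤ B`. This lets the unit of `4 n r` queries cover
    -- `n` of them.
    1≤r : 1 ℕ.≤ r
    1≤r = ℕ.≤-trans (Subroutines.nonempty⇒0<∣∣ F {X = ⁅ Fin.zero {n′} ⁆} (Fin.zero , x∈⁅x⁆ Fin.zero))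
      (∣∣≤r ⁅ Fin.zero {n′} ⁆ (cost-singleton (proj₁ 0<B) c≤B Fin.zero))
    r≤n : r ℕ.≤ n
    r≤n = ≡.subst (ℕ._≤ n) ∣X∣≡r (∣p∣≤n X)

    n≤4nr : n ℕ.≤ 4 ℕ.* (n ℕ.* r)
    n≤4nr = ℕ.≤-trans (≤-scale n 1≤r) (ℕ.m≤m+n (n ℕ.* r) _)
    1≤4nr : 1 ℕ.≤ 4 ℕ.* (n ℕ.* r)
    1≤4nr = ℕ.≤-trans (s≤s z≤n) n≤4nr
    n≤6nj : n ℕ.≤ 6 ℕ.* (n ℕ.* lg r)
    n≤6nj = ℕ.≤-trans (≤-scale n {lg r} (s≤s z≤n)) (ℕ.m≤m+n (n ℕ.* lg r) _)
    1≤6nj : 1 ℕ.≤ 6 ℕ.* (n ℕ.* lg r)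
    1≤6nj = ℕ.≤-trans (s≤s z≤n) n≤6nj

    -- `suc d` is at most `2 r`, and each of the two summands at most `2 r n`; hence the 4.
    exhaustive≤ : ∀ {d} → d ℕ.≤ r → suc d ℕ.+ suc d ℕ.* n ℕ.≤ 4 ℕ.* (n ℕ.* r)
    exhaustive≤ {d} d≤r = ℕ.≤-trans
      (ℕ.+-mono-≤ (ℕ.≤-trans d< (≤-scale (r ℕ.+ r) {n} (s≤s z≤n))) (ℕ.*-monoˡ-≤ n d<))
      (ℕ.≤-reflexive (collect r n))
      where
      d< : suc d ℕ.≤ r ℕ.+ r
      d< = ℕ.+-mono-≤ 1≤r d≤r
      collect : ∀ r n → (r ℕ.+ r) ℕ.* n ℕ.+ (r ℕ.+ r) ℕ.* n ≡ 4 ℕ.* (n ℕ.* r)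
      collect = solve-∀

    -- One probe asks at most `suc d + n ≤ 3 n` sets, by `r ≤ n`; two bisections make it 6.
    binary≤ : ∀ {d} → d ℕ.≤ r →
              lg r ℕ.* (suc d ℕ.+ n) ℕ.+ lg r ℕ.* (suc d ℕ.+ n) ℕ.≤ 6 ℕ.* (n ℕ.* lg r)
    binary≤ {d} d≤r = ℕ.≤-trans (ℕ.+-mono-≤ each each) (ℕ.≤-reflexive (collect (lg r) n))
      where
      each : lg r ℕ.* (suc d ℕ.+ n) ℕ.≤ lg r ℕ.* ((n ℕ.+ n) ℕ.+ n)
      each = ℕ.*-monoʳ-≤ (lg r) (ℕ.+-monoˡ-≤ n (ℕ.+-mono-≤ {1} {n} (s≤s z≤n) (ℕ.≤-trans d≤r r≤n)))
      collect : ∀ j n → j ℕ.* ((n ℕ.+ n) ℕ.+ n) ℕ.+ j ℕ.* ((n ℕ.+ n) ℕ.+ n) ≡ 6 ℕ.* (n ℕ.* j)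
      collect = solve-∀

    collect₁ : ∀ Q l n r → Q ℕ.* (l ℕ.* (l ℕ.* 1) ℕ.* (4 ℕ.* (n ℕ.* r))) ≡
               4 ℕ.* Q ℕ.* (n ℕ.* r ℕ.* (l ℕ.* (l ℕ.* 1)))
    collect₁ = solve-∀
    collect₂ : ∀ R l j → R ℕ.* (l ℕ.* (j ℕ.+ j)) ≡ 2 ℕ.* R ℕ.* (l ℕ.* j)
    collect₂ = solve-∀
    collect₃ : ∀ Q l n j → Q ℕ.* (l ℕ.* (l ℕ.* 1) ℕ.* (6 ℕ.* (n ℕ.* j))) ≡
               6 ℕ.* Q ℕ.* (n ℕ.* (l ℕ.* (l ℕ.* 1)) ℕ.* j)
    collect₃ = solve-∀
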